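{- Let $\Delta,k\in\mathbb{N}$ with $\Delta\geq 3$ and $k\geq 5$. Then there exists a $\Delta$-regular graph $G$ on $n=2k(\Delta+1)$ vertices that satisfies the following. Let $\mathcal{H}$ denote the subgraph of the $(\Delta+1)$-recolouring graph of $G$ induced by the set $\Omega(G)\setminus\Omega^*(G)$ of non-frozen $(\Delta+1)$-colourings. Then the Glauber dynamics for $(\Delta+1)$-colourings of $G$ restricted to $V(\mathcal{H})$ is ergodic and has mixing time at least $$\frac{n^2}{8(\Delta+1)}.$$
   Context: All graphs are finite, simple and labeled, with vertex set $[n]=\{1,\dots,n\}$. A (proper) $k$-colouring of $G$ is a function $\alpha:V(G)\to[k]$ with $\alpha(x)\neq\alpha(y)$ for every edge $xy$. The $k$-recolouring graph of $G$ has as vertices the proper $k$-colourings of $G$, two being adjacent if and only if they differ at exactly one vertex of $G$. For $G$ of maximum degree $\Delta$, $\Omega(G)$ is the set of proper $(\Delta+1)$-colourings of $G$, and $\Omega^*(G)$ is the set of frozen ones, i.e. those $\alpha\in\Omega(G)$ such that for every vertex $v$ all $\Delta+1$ colours appear in the closed neighbourhood $N[v]=N(v)\cup\{v\}$. (Frozen colourings are fixed points of the Glauber dynamics defined next and are isolated vertices of the recolouring graph.) The Glauber dynamics for $k$-colourings of $G$ is the Markov chain $(X_t)$ on the set of proper $k$-colourings of $G$ with the following transitions: choose $v\in[n]$ and $c\in[k]$ independently and uniformly at random; set $X_{t+1}(u)=X_t(u)$ for all $u\neq v$; if $c$ does not appear (under $X_t$) on the neighbours of $v$, set $X_{t+1}(v)=c$,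 otherwise set $X_{t+1}(v)=X_t(v)$. Ergodic means irreducible and aperiodic. For an irreducible aperiodic Markov chain on a finite set $\Omega$ with transition matrix $P$ and stationary distribution $\pi$, let $d(t)=\max_{x\in\Omega}\|P^t(x,\cdot)-\pi\|_{TV}$, where $\|\mu-\nu\|_{TV}=\max_{A\subseteq\Omega}|\mu(A)-\nu(A)|$. The mixing time is $\min\{t: d(t)\leq 1/4\}$. -}

module Defs where

open import Data.Bool.Base using (if_then_else_)
open import Data.Fin.Base using (Fin)
open import Data.Fin.Properties using (_≟_; any?; all?)
open import Data.Fin.Subset using (Subset; inside; outside) renaming (∣_∣ to card)
open import Data.Integer.Base using (+_)
open import Data.List.Base using (List; []; _∷_; [_]; allFin; cartesianProductWith; filter; foldr; length; map)
import Data.List.Base as List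
open import Data.Nat.Base as ℕ using (ℕ; zero; suc)
open import Data.Nat.Divisibility using (_∣_)
open import Data.Product.Base using (∃-syntax; _×_)
open import Data.Rational.Base using (ℚ; 0ℚ; 1ℚ; _+_; _*_; _-_; _⊔_; ∣_∣; _≤_; _<_; _/_)
open import Data.Rational.Properties using (+-0-commutativeMonoid)
open import Data.Sum.Base using (_⊎_)
open import Data.Vec.Base using (Vec; []; _∷_; lookup; tabulate; _[_]≔_)
open import Data.Vec.Properties using (≡-dec)
open import Level using (0ℓ)
open import Relation.Binary.Core using (Rel)
open import Relation.Binary.Definitions using (Decidable; Irreflexive; Symmetric)
open import Relation.Binary.PropositionalEquality.Core using (_≡_; _≢_)
open import Relation.Nullary.Decidable using (Dec; does; ¬?; _×-dec_; _⊎-dec_; _→-dec_)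

open import Algebra.Properties.CommutativeMonoid.Sum +-0-commutativeMonoid using (sum-syntax)

allVecs : ∀ {A : Set} → List A → ∀ n → List (Vec A n)
allVecs xs zero    = [ [] ]
allVecs xs (suc n) = cartesianProductWith _∷_ xs (allVecs xs n)

indicator : ∀ {A : Set} → Dec A → ℚ
indicator A? = if does A? then 1ℚ else 0ℚ

-- All suprema below are of non-negative rationals, so starting from 0 is harmless.
maximum : List ℚ → ℚ
maximum = foldr _⊔_ 0ℚ

uniform : ∀ {n} → Fin n → ℚ
uniform {suc n} _ = + 1 / suc n

-- Rational entries suffice: an irreducible chain with rational transition
-- probabilities has a rational stationary distribution.

Distribution : ℕ → Set
Distribution m = Fin m → ℚ

Matrix : ℕ → Set
Matrix m = Fin m → Fin m → ℚ

IsDistribution : ∀ {m} → Distribution m → Set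
IsDistribution {m} μ = (∀ x → 0ℚ ≤ μ x) × (∑[ x < m ] μ x) ≡ 1ℚ

power : ∀ {m} → Matrix m → ℕ → Matrix m
power     P zero    x y = indicator (x ≟ y)
power {m} P (suc t) x y = ∑[ z < m ] (P x z * power P t z y)

IsStochastic : ∀ {m} → Matrix m → Set
IsStochastic P = ∀ x → IsDistribution (P x)

IsIrreducible : ∀ {m} → Matrix m → Set
IsIrreducible P = ∀ x y → ∃[ t ] 0ℚ < power P t x y

-- For each x, the greatest common divisor of the return times to x is 1.
IsAperiodic : ∀ {m} → Matrix m → Set
IsAperiodic P = ∀ x d → (∀ t → 1 ℕ.≤ t → 0ℚ < power P t x x → d ∣ t) → d ≡ 1

record IsErgodic {m} (P : Matrix m) : Set where
  field
    stochastic  : IsStochastic P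
    irreducible : IsIrreducible P
    aperiodic   : IsAperiodic P

IsStationary : ∀ {m} → Matrix m → Distribution m → Set
IsStationary {m} P π = IsDistribution π × (∀ y → (∑[ x < m ] (π x * P x y)) ≡ π y)

measure : ∀ {m} → Distribution m → Subset m → ℚ
measure {m} μ A = ∑[ x < m ] (if lookup A x then μ x else 0ℚ)

tvDistance : ∀ {m} → Distribution m → Distribution m → ℚ
tvDistance {m} μ ν =
  maximum (map (λ A → ∣ measure μ A - measure ν A ∣) (allVecs (inside ∷ outside ∷ []) m))

distanceAt : ∀ {m} → Matrix m → Distribution m → ℕ → ℚ
distanceAt {m} P π t = maximum (map (λ x → tvDistance (power P t x) π) (allFin m))

record IsMixingTime {m} (P : Matrix m) (τ : ℕ) : Set where
  field
    π          : Distribution m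
    stationary : IsStationary P π
    mixed      : distanceAt P π τ ≤ + 1 / 4
    least      : ∀ t → distanceAt P π t ≤ + 1 / 4 → τ ℕ.≤ t

restrict : ∀ {S : Set} → (S → S → ℚ) → (xs : List S) → Matrix (length xs)
restrict P xs i j = P (List.lookup xs i) (List.lookup xs j)

record Graph (n : ℕ) : Set₁ where
  field
    Adj    : Rel (Fin n) 0ℓ
    adj?   : Decidable Adj
    sym    : Symmetric Adj
    irrefl : Irreflexive _≡_ Adj

  neighbours : Fin n → Subset n
  neighbours v = tabulate (λ u → does (adj? v u))

  degree : Fin n → ℕ
  degree v = card (neighbours v)

  IsRegular : ℕ → Set
  IsRegular d = ∀ v → degree v ≡ d

-- Vectors rather than functions, so that colourings have decidable
-- propositional equality.
Colouring : ℕ → ℕ → Set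
Colouring k n = Vec (Fin k) n

module _ {n} (G : Graph n) {k : ℕ} where
  open Graph G

  Proper : Colouring k n → Set
  Proper α = ∀ x y → Adj x y → lookup α x ≢ lookup α y

  proper? : ∀ α → Dec (Proper α)
  proper? α = all? λ x → all? λ y → adj? x y →-dec ¬? (lookup α x ≟ lookup α y)

  Appears : Colouring k n → Fin n → Fin k → Set
  Appears α v c = ∃[ u ] (Adj v u × lookup α u ≡ c)

  appears? : ∀ α v c → Dec (Appears α v c)
  appears? α v c = any? λ u → adj? v u ×-dec (lookup α u ≟ c)

  Frozen : Colouring k n → Set
  Frozen α = ∀ v c → ∃[ u ] ((u ≡ v ⊎ Adj v u) × lookup α u ≡ c)

  frozen? : ∀ α → Dec (Frozen α)
  frozen? α = all? λ v → all? λ c → any? λ u → ((u ≟ v) ⊎-dec adj? v u) ×-dec (lookup α u ≟ c)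

  glauberStep : Colouring k n → Fin n → Fin k → Colouring k n
  glauberStep α v c = if does (appears? α v c) then α else α [ v ]≔ c

  glauber : Colouring k n → Colouring k n → ℚ
  glauber α β =
    ∑[ v < n ] ∑[ c < k ] (uniform v * uniform c * indicator (≡-dec _≟_ (glauberStep α v c) β))

properColourings : ∀ {n} → Graph n → ∀ k → List (Colouring k n)
properColourings {n} G k = filter (proper? G) (allVecs (allFin k) n)

nonFrozenColourings : ∀ {n} → Graph n → ∀ k → List (Colouring k n)
nonFrozenColourings G k = filter (λ α → ¬? (frozen? G α)) (properColourings G k)

nonFrozenGlauber : ∀ {n} (G : Graph n) (k : ℕ) → Matrix (length (nonFrozenColourings G k))
nonFrozenGlauber G k = restrict (glauber G) (nonFrozenColourings G k)

{-# OPTIONS --safe #-}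

-- The graph is a cyclic necklace of 2k blobs, each a copy of K_{Δ+1} minus an edge uv, where the v of
-- every blob is joined to the u of the next one.
--
-- Connectivity.  A blob in which u and v agree misses a colour, so its colours can be permuted freely.
-- It can move away from the colour wanted by the u of the next blob, and u and v of that blob then agree
-- as well; this propagates around the necklace.  A non-frozen colouring without such a blob has one after
-- a single move.  When u and v agree in every blob, one is left with recolouring a cycle of even length
-- with Δ+1 ≥ 4 colours, and with sorting the remaining vertices of the blobs through the missing colour.
--
-- Mixing time.  The transition matrix is symmetric, so the uniform distribution is stationary.  Call a
-- blob intact if (u, v) is coloured (0, 1).  An intact blob between two intact blobs cannot move, so an
-- interval of intact blobs is eroded only at its two ends, at each end by one of the n(Δ+1) choices of a
-- vertex and a colour.  If initially all blobs but one are intact, the expected radius of the intact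
-- interval around the opposite blob is at least k − 2t/(n(Δ+1)) after t steps.  As the radius is at most k,
-- and 0 unless the opposite blob is intact, that blob is intact with probability at least
-- 1 − 2t/(kn(Δ+1)); in the stationary distribution this probability is at most 1/2, by exchanging the
-- colours 0 and 1.  Hence mixing forces t ≥ kn(Δ+1)/8 ≥ n²/(8(Δ+1)).

module Submission where

open import Defs
open import Data.Nat.Base as ℕ using (ℕ; zero; suc)
open import Relation.Binary.PropositionalEquality
open import Data.Bool.Base using (true; false; if_then_else_)
open import Data.Fin.Base
  using (Fin; zero; suc; toℕ; inject₁; combine; remQuot; _↑ˡ_; _↑ʳ_; punchOut; fromℕ<)
open import Data.Fin.Patterns using (0F; 1F; 2F)
open import Data.Fin.Properties
  using (_≟_; all?; any?; ¬∀⟶∃¬; toℕ-inject₁; toℕ-fromℕ; remQuot-combine; combine-injective;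
    combine-surjective; <⇒notInjective; punchOut-injective; suc-injective; toℕ-fromℕ<;
    toℕ-injective)
open import Data.Parity.Base using (Parity; 1ℙ; _⁻¹; 0ℙ)
open import Data.Product.Base using (_,_; ∃-syntax; _×_; proj₁; proj₂; uncurry; Σ-syntax)
open import Data.Sum.Base using (inj₁; inj₂; _⊎_)
open import Data.Vec.Properties
  using (≡-dec; lookup-map; map-∘; map-cong; map-id; lookup∘update; lookup∘update′; []≔-lookup;
    []≔-idempotent; ∷-injective; lookup∘tabulate; tabulate∘lookup; tabulate-cong)
open import Function.Base using (case_of_; _∘_)
open import Relation.Nullary.Decidable
  using (Dec; yes; no; dec-true; dec-false; _×-dec_; _⊎-dec_; does; ¬?; _→-dec_)
open import Relation.Nullary.Negation using (¬_; contradiction)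

-- Rational arithmetic, indicators and finite sums

module RationalSums where

  import Data.Nat.Properties as ℕ
  import Data.Integer.Base as ℤ
  import Data.Integer.Properties as ℤ
  open import Data.Integer.Base using (+_)
  open import Data.Rational.Base
  open import Data.Rational.Properties hiding (_≟_)
  open import Data.Rational.Solver
  import Data.Rational.Unnormalised.Base as ℚᵘ
  import Data.Rational.Unnormalised.Properties as ℚᵘ
  open import Algebra.Bundles using (CommutativeRing)
  open import Algebra.Properties.CommutativeMonoid.Sum +-0-commutativeMonoid
  import Algebra.Properties.Semiring.Sum as SemiringSum
  open import Data.Vec.Functional using (Vector)
  open +-*-Solver

  0≤1 : 0ℚ ≤ 1ℚ
  0≤1 = *≤* (ℤ.+≤+ ℕ.z≤n)

  0<1 : 0ℚ < 1ℚ
  0<1 = *<* (ℤ.+<+ (ℕ.s≤s ℕ.z≤n))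

  p≤q⇒0≤q-p : ∀ {p q} → p ≤ q → 0ℚ ≤ q - p
  p≤q⇒0≤q-p {p} {q} p≤q = subst (_≤ q - p) (+-inverseʳ p) (+-monoˡ-≤ (- p) p≤q)

  0≤q-p⇒p≤q : ∀ {p q} → 0ℚ ≤ q - p → p ≤ q
  0≤q-p⇒p≤q {p} {q} 0≤q-p = subst₂ _≤_ (+-identityʳ p) (solve 2 (λ p q → p :+ (q :- p) := q) refl p q) (+-monoʳ-≤ p 0≤q-p)

  0≤*0≤ : ∀ {p q} → 0ℚ ≤ p → 0ℚ ≤ q → 0ℚ ≤ p * q
  0≤*0≤ {p} {q} 0≤p 0≤q = nonNegative⁻¹ (p * q) {{nonNeg*nonNeg⇒nonNeg p {{nonNegative 0≤p}} q {{nonNegative 0≤q}}}}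

  0<*0< : ∀ {p q} → 0ℚ < p → 0ℚ < q → 0ℚ < p * q
  0<*0< {p} {q} 0<p 0<q = positive⁻¹ (p * q) {{pos*pos⇒pos p {{positive 0<p}} q {{positive 0<q}}}}

  0≤+0≤ : ∀ {p q} → 0ℚ ≤ p → 0ℚ ≤ q → 0ℚ ≤ p + q
  0≤+0≤ = +-mono-≤

  *-monoˡ-≤′ : ∀ {p q r} → 0ℚ ≤ r → p ≤ q → r * p ≤ r * q
  *-monoˡ-≤′ {r = r} 0≤r = *-monoˡ-≤-nonNeg r {{nonNegative 0≤r}}

  ∣-∣≤ : ∀ {p q} → p ≤ q → - q ≤ p → ∣ p ∣ ≤ q
  ∣-∣≤ {p} {q} p≤q -q≤p with ∣p∣≡p∨∣p∣≡-p p
  ... | inj₁ eq = subst (_≤ q) (sym eq) p≤q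
  ... | inj₂ eq = subst₂ _≤_ (sym eq) (solve 1 (λ q → :- (:- q) := q) refl q) (neg-antimono-≤ -q≤p)

  p≤∣p∣ : ∀ p → p ≤ ∣ p ∣
  p≤∣p∣ p with ≤-total 0ℚ p
  ... | inj₁ 0≤p = ≤-reflexive (sym (0≤p⇒∣p∣≡p 0≤p))
  ... | inj₂ p≤0 = ≤-trans p≤0 (0≤∣p∣ p)

  fromℕ : ℕ → ℚ
  fromℕ n = + n / 1

  -- Forming `+ n / 1` normalises the fraction, so the equation is checked on unnormalised
  -- representatives, where it is plain integer arithmetic.
  fromℕ-+ : ∀ m n → fromℕ (m ℕ.+ n) ≡ fromℕ m + fromℕ n
  fromℕ-+ m n = toℚᵘ-injective (begin
    toℚᵘ (fromℕ (m ℕ.+ n))                    ≈⟨ toℚᵘ-fromℚᵘ (ℚᵘ.mkℚᵘ (+ (m ℕ.+ n)) 0) ⟩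
    ℚᵘ.mkℚᵘ (+ (m ℕ.+ n)) 0                   ≈⟨ ℚᵘ.*≡*
                                               (cong (ℤ._* + 1) (cong₂ ℤ._+_ (sym (ℤ.*-identityʳ (+ m))) (sym (ℤ.*-identityʳ (+ n))))) ⟩
    ℚᵘ.mkℚᵘ (+ m) 0 ℚᵘ.+ ℚᵘ.mkℚᵘ (+ n) 0      ≈⟨ ℚᵘ.+-cong (toℚᵘ-fromℚᵘ (ℚᵘ.mkℚᵘ (+ m) 0)) (toℚᵘ-fromℚᵘ (ℚᵘ.mkℚᵘ (+ n) 0)) ⟨
    toℚᵘ (fromℕ m) ℚᵘ.+ toℚᵘ (fromℕ n)        ≈⟨ toℚᵘ-homo-+ (fromℕ m) (fromℕ n) ⟨
    toℚᵘ (fromℕ m + fromℕ n)                  ∎)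
    where open ℚᵘ.≃-Reasoning

  fromℕ-* : ∀ m n → fromℕ (m ℕ.* n) ≡ fromℕ m * fromℕ n
  fromℕ-* zero    n = sym (*-zeroˡ (fromℕ n))
  fromℕ-* (suc m) n = begin
    fromℕ (n ℕ.+ m ℕ.* n)          ≡⟨ fromℕ-+ n (m ℕ.* n) ⟩
    fromℕ n + fromℕ (m ℕ.* n)      ≡⟨ cong (λ z → fromℕ n + z) (fromℕ-* m n) ⟩
    fromℕ n + fromℕ m * fromℕ n    ≡⟨ solve 2 (λ m n → n :+ m :* n := (con 1ℚ :+ m) :* n) refl (fromℕ m) (fromℕ n) ⟩
    (1ℚ + fromℕ m) * fromℕ n       ≡⟨ cong (_* fromℕ n) (fromℕ-+ 1 m) ⟨
    fromℕ (suc m) * fromℕ n        ∎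
    where open ≡-Reasoning

  fromℕ-mono : ∀ {m n} → m ℕ.≤ n → fromℕ m ≤ fromℕ n
  fromℕ-mono {m} {n} m≤n = toℚᵘ-cancel-≤ (begin
    toℚᵘ (fromℕ m)     ≃⟨ toℚᵘ-fromℚᵘ (ℚᵘ.mkℚᵘ (+ m) 0) ⟩
    ℚᵘ.mkℚᵘ (+ m) 0    ≤⟨ ℚᵘ.*≤* (ℤ.*-monoʳ-≤-nonNeg (+ 1) (ℤ.+≤+ m≤n)) ⟩
    ℚᵘ.mkℚᵘ (+ n) 0    ≃⟨ toℚᵘ-fromℚᵘ (ℚᵘ.mkℚᵘ (+ n) 0) ⟨
    toℚᵘ (fromℕ n)     ∎)
    where open ℚᵘ.≤-Reasoning

  0≤fromℕ : ∀ n → 0ℚ ≤ fromℕ n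
  0≤fromℕ n = fromℕ-mono {0} {n} ℕ.z≤n

  fromℕ-*-/ : ∀ m n .{{_ : ℕ.NonZero n}} → fromℕ n * (+ m / n) ≡ fromℕ m
  fromℕ-*-/ m n@(suc n-1) = toℚᵘ-injective (begin
    toℚᵘ (fromℕ n * (+ m / n))              ≈⟨ toℚᵘ-homo-* (fromℕ n) (+ m / n) ⟩
    toℚᵘ (fromℕ n) ℚᵘ.* toℚᵘ (+ m / n)      ≈⟨ ℚᵘ.*-cong (toℚᵘ-fromℚᵘ (ℚᵘ.mkℚᵘ (+ n) 0)) (toℚᵘ-fromℚᵘ (ℚᵘ.mkℚᵘ (+ m) n-1)) ⟩
    ℚᵘ.mkℚᵘ (+ n) 0 ℚᵘ.* ℚᵘ.mkℚᵘ (+ m) n-1  ≈⟨ ℚᵘ.*≡* (trans (ℤ.*-identityʳ _)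
                                               (trans (ℤ.*-comm (+ n) (+ m)) (cong (λ z → + m ℤ.* + z) (sym (ℕ.+-identityʳ n))))) ⟩
    ℚᵘ.mkℚᵘ (+ m) 0                         ≈⟨ toℚᵘ-fromℚᵘ (ℚᵘ.mkℚᵘ (+ m) 0) ⟨
    toℚᵘ (fromℕ m)                          ∎)
    where open ℚᵘ.≃-Reasoning

  -- A positive rational with denominator d is at least 1/d, so n · d copies of it reach n.
  archimedean : ∀ {δ} → 0ℚ < δ → ∀ n → ∃[ s ] fromℕ n ≤ fromℕ s * δ
  archimedean {δ@(mkℚ _ d-1 _)} 0<δ n = n ℕ.* d , (begin
    fromℕ n                        ≡⟨ *-identityʳ (fromℕ n) ⟨
    fromℕ n * 1ℚ                   ≤⟨ *-monoˡ-≤′ (0≤fromℕ n) (step δ 0<δ) ⟩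
    fromℕ n * (fromℕ d * δ)        ≡⟨ *-assoc (fromℕ n) (fromℕ d) δ ⟨
    fromℕ n * fromℕ d * δ          ≡⟨ cong (_* δ) (fromℕ-* n d) ⟨
    fromℕ (n ℕ.* d) * δ            ∎)
    where
    open ≤-Reasoning
    d = suc d-1
    step : ∀ δ → 0ℚ < δ → 1ℚ ≤ fromℕ (↧ₙ δ) * δ
    step (mkℚ (+ zero) _ _) (*<* (ℤ.+<+ ()))
    step δ@(mkℚ (+ suc a) d-1 _) _ = begin
      1ℚ                                        ≤⟨ fromℕ-mono {1} {suc a} (ℕ.s≤s ℕ.z≤n) ⟩
      fromℕ (suc a)                             ≡⟨ fromℕ-*-/ (suc a) (suc d-1) ⟨
      fromℕ (suc d-1) * (+ suc a / suc d-1)     ≡⟨ cong (fromℕ (suc d-1) *_) (↥p/↧p≡p δ) ⟩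
      fromℕ (suc d-1) * δ                       ∎
    step (mkℚ ℤ.-[1+ _ ] _ _) (*<* ())

  indicator-yes : ∀ {A : Set} (A? : Dec A) → A → indicator A? ≡ 1ℚ
  indicator-yes A? a rewrite dec-true A? a = refl

  indicator-no : ∀ {A : Set} (A? : Dec A) → ¬ A → indicator A? ≡ 0ℚ
  indicator-no A? ¬a rewrite dec-false A? ¬a = refl

  indicator-cong : ∀ {A B : Set} (A? : Dec A) (B? : Dec B) → (A → B) → (B → A) → indicator A? ≡ indicator B?
  indicator-cong (yes a) B? f g = sym (indicator-yes B? (f a))
  indicator-cong (no ¬a) B? f g = sym (indicator-no B? (λ b → ¬a (g b)))

  0≤indicator : ∀ {A : Set} (A? : Dec A) → 0ℚ ≤ indicator A?
  0≤indicator (yes _) = 0≤1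
  0≤indicator (no _)  = ≤-refl

  *-distribˡ-∑ : ∀ {n} c (f : Vector ℚ n) → c * ∑[ i < n ] f i ≡ ∑[ i < n ] (c * f i)
  *-distribˡ-∑ = SemiringSum.*-distribˡ-sum (CommutativeRing.semiring +-*-commutativeRing)

  *-distribʳ-∑ : ∀ {n} c (f : Vector ℚ n) → (∑[ i < n ] f i) * c ≡ ∑[ i < n ] (f i * c)
  *-distribʳ-∑ = SemiringSum.*-distribʳ-sum (CommutativeRing.semiring +-*-commutativeRing)

  ∑-zero : ∀ {n} {f : Vector ℚ n} → (∀ i → f i ≡ 0ℚ) → ∑[ i < n ] f i ≡ 0ℚ
  ∑-zero {n} f≡0 = trans (sum-cong-≗ f≡0) (sum-replicate-zero n)

  ∑-mono : ∀ {n} {f g : Vector ℚ n} → (∀ i → f i ≤ g i) → ∑[ i < n ] f i ≤ ∑[ i < n ] g i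
  ∑-mono {zero}  f≤g = ≤-refl
  ∑-mono {suc n} f≤g = +-mono-≤ (f≤g zero) (∑-mono (λ i → f≤g (suc i)))

  0≤∑ : ∀ {n} {f : Vector ℚ n} → (∀ i → 0ℚ ≤ f i) → 0ℚ ≤ ∑[ i < n ] f i
  0≤∑ {n} {f} 0≤f = subst (_≤ sum f) (∑-zero {n} (λ _ → refl)) (∑-mono 0≤f)

  term≤∑ : ∀ {n} {f : Vector ℚ n} → (∀ i → 0ℚ ≤ f i) → ∀ i → f i ≤ ∑[ j < n ] f j
  term≤∑ {f = f} 0≤f zero    = subst (_≤ sum f) (+-identityʳ (f zero)) (+-monoʳ-≤ (f zero) (0≤∑ (λ i → 0≤f (suc i))))
  term≤∑ {f = f} 0≤f (suc i) = ≤-trans (term≤∑ (λ j → 0≤f (suc j)) i)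
    (subst (_≤ sum f) (+-identityˡ _) (+-monoˡ-≤ _ (0≤f zero)))

  0<∑ : ∀ {n} {f : Vector ℚ n} → (∀ i → 0ℚ ≤ f i) → ∀ i → 0ℚ < f i → 0ℚ < ∑[ j < n ] f j
  0<∑ 0≤f i 0<fi = <-≤-trans 0<fi (term≤∑ 0≤f i)

  ∑-indicator : ∀ {n} (i : Fin n) (f : Vector ℚ n) → ∑[ j < n ] (indicator (i ≟ j) * f j) ≡ f i
  ∑-indicator zero f = begin
    1ℚ * f zero + ∑[ j < _ ] (0ℚ * f (suc j))  ≡⟨ cong₂ _+_ (*-identityˡ (f zero)) (∑-zero (λ j → *-zeroˡ (f (suc j)))) ⟩
    f zero + 0ℚ                                ≡⟨ +-identityʳ (f zero) ⟩
    f zero                                     ∎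
    where open ≡-Reasoning
  ∑-indicator (suc i) f = begin
    0ℚ * f zero + ∑[ j < _ ] (indicator (suc i ≟ suc j) * f (suc j))  ≡⟨ cong₂ _+_ (*-zeroˡ (f zero)) (∑-indicator i (λ j → f (suc j))) ⟩
    0ℚ + f (suc i)                                                    ≡⟨ +-identityˡ (f (suc i)) ⟩
    f (suc i)                                                         ∎
    where open ≡-Reasoning

  ∑-indicatorʳ : ∀ {n} (i : Fin n) (f : Vector ℚ n) → ∑[ j < n ] (indicator (j ≟ i) * f j) ≡ f i
  ∑-indicatorʳ i f = trans (sum-cong-≗ (λ j → cong (_* f j) (indicator-cong (j ≟ i) (i ≟ j) sym sym))) (∑-indicator i f)

  0≤uniform : ∀ {n} (i : Fin n) → 0ℚ ≤ uniform i
  0≤uniform {suc n} _ = nonNegative⁻¹ _ {{normalize-nonNeg 1 (suc n)}}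

  0<uniform : ∀ {n} (i : Fin n) → 0ℚ < uniform i
  0<uniform {suc n} _ = positive⁻¹ _ {{normalize-pos 1 (suc n)}}

  fromℕ*uniform : ∀ {n} (i : Fin n) → fromℕ n * uniform i ≡ 1ℚ
  fromℕ*uniform {suc n} _ = fromℕ-*-/ 1 (suc n)

  uniform-const : ∀ {n} (i j : Fin n) → uniform i ≡ uniform j
  uniform-const {suc n} _ _ = refl

  ∑-const : ∀ n c → ∑[ i < n ] c ≡ fromℕ n * c
  ∑-const zero    c = sym (*-zeroˡ c)
  ∑-const (suc n) c = begin
    c + ∑[ i < n ] c        ≡⟨ cong (λ z → c + z) (∑-const n c) ⟩
    c + fromℕ n * c         ≡⟨ solve 2 (λ c n → c :+ n :* c := (con 1ℚ :+ n) :* c) refl c (fromℕ n) ⟩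
    (1ℚ + fromℕ n) * c      ≡⟨ cong (_* c) (fromℕ-+ 1 n) ⟨
    fromℕ (suc n) * c       ∎
    where open ≡-Reasoning

  ∑-uniform : ∀ {n} → Fin n → ∑[ i < n ] uniform i ≡ 1ℚ
  ∑-uniform {n} i = begin
    ∑[ j < n ] uniform j    ≡⟨ sum-cong-≗ (λ j → uniform-const j i) ⟩
    ∑[ j < n ] uniform i    ≡⟨ ∑-const n (uniform i) ⟩
    fromℕ n * uniform i     ≡⟨ fromℕ*uniform i ⟩
    1ℚ                      ∎
    where open ≡-Reasoning

-- Finite Markov chains: expectations, convergence, existence of the mixing time

module MarkovChains where

  import Data.Nat.Properties as ℕ
  open import Data.Nat.Divisibility using (∣1⇒≡1)
  open import Data.Fin.Subset using (inside; outside)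
  import Data.Integer.Base as ℤ
  import Data.Integer.Properties as ℤ
  open import Data.Integer.Base using (+_)
  open import Data.List.Base using (List; []; _∷_; allFin)
  open import Data.List.Membership.Propositional using (_∈_)
  open import Data.List.Membership.Propositional.Properties
    using (∈-allFin; ∈-cartesianProductWith⁺; ∈-map⁺; ∈-map⁻)
  open import Data.List.Relation.Unary.Any using (here; there)
  open import Data.Vec.Base as Vec using (Vec; lookup)
  open import Data.Rational.Base
  open import Data.Rational.Properties hiding (_≟_)
  open import Data.Rational.Solver
  open import Algebra.Properties.CommutativeMonoid.Sum +-0-commutativeMonoid
  open import Data.Nat.Induction using (<-rec)
  open RationalSums
  open +-*-Solver

  ∈-allVecs : ∀ {A : Set} (xs : List A) → (∀ a → a ∈ xs) → ∀ n (v : Vec A n) → v ∈ allVecs xs n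
  ∈-allVecs xs all zero    Vec.[]      = here refl
  ∈-allVecs xs all (suc n) (a Vec.∷ v) = ∈-cartesianProductWith⁺ Vec._∷_ (all a) (∈-allVecs xs all n v)

  maximum-≤ : ∀ {c} xs → 0ℚ ≤ c → (∀ {x} → x ∈ xs → x ≤ c) → maximum xs ≤ c
  maximum-≤ []       0≤c xs≤c = 0≤c
  maximum-≤ (x ∷ xs) 0≤c xs≤c = ⊔-lub (xs≤c (here refl)) (maximum-≤ xs 0≤c (λ x∈ → xs≤c (there x∈)))

  ≤-maximum : ∀ {x xs} → x ∈ xs → x ≤ maximum xs
  ≤-maximum {xs = y ∷ xs} (here refl) = p≤p⊔q y (maximum xs)
  ≤-maximum {xs = y ∷ xs} (there x∈)  = ≤-trans (≤-maximum x∈) (p≤q⊔p y (maximum xs))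

  if-* : ∀ b p → (if b then p else 0ℚ) ≡ p * (if b then 1ℚ else 0ℚ)
  if-* true  p = sym (*-identityʳ p)
  if-* false p = sym (*-zeroʳ p)

  module Chain {m} (P : Matrix m) (stochastic : IsStochastic P) where

    0≤P : ∀ x y → 0ℚ ≤ P x y
    0≤P x y = proj₁ (stochastic x) y

    ∑P : ∀ x → ∑[ y < m ] P x y ≡ 1ℚ
    ∑P x = proj₂ (stochastic x)

    average : (Fin m → ℚ) → Fin m → ℚ
    average f x = ∑[ z < m ] (P x z * f z)

    -- The operator P^t applied to f, that is, the expectation of f(X_t) given X_0 = x.
    expect : ℕ → (Fin m → ℚ) → Fin m → ℚ
    expect t f x = ∑[ y < m ] (power P t x y * f y)

    average-mono : ∀ {f g} → (∀ z → f z ≤ g z) → ∀ x → average f x ≤ average g x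
    average-mono f≤g x = ∑-mono (λ z → *-monoˡ-≤′ (0≤P x z) (f≤g z))

    average-affine : ∀ a b f x → average (λ z → a + b * f z) x ≡ a + b * average f x
    average-affine a b f x = begin
      ∑[ z < m ] (P x z * (a + b * f z))
        ≡⟨ sum-cong-≗ (λ z → solve 4 (λ p a b f → p :* (a :+ b :* f) := p :* a :+ b :* (p :* f)) refl (P x z) a b (f z)) ⟩
      ∑[ z < m ] (P x z * a + b * (P x z * f z))
        ≡⟨ ∑-distrib-+ (λ z → P x z * a) (λ z → b * (P x z * f z)) ⟩
      ∑[ z < m ] (P x z * a) + ∑[ z < m ] (b * (P x z * f z))
        ≡⟨ cong₂ _+_ (*-distribʳ-∑ a (P x)) (*-distribˡ-∑ b (λ z → P x z * f z)) ⟨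
      (∑[ z < m ] P x z) * a + b * average f x
        ≡⟨ cong (λ s → s * a + b * average f x) (∑P x) ⟩
      1ℚ * a + b * average f x
        ≡⟨ cong (_+ b * average f x) (*-identityˡ a) ⟩
      a + b * average f x ∎
      where open ≡-Reasoning

    expect-zero : ∀ f x → expect 0 f x ≡ f x
    expect-zero f x = ∑-indicator x f

    expect-suc : ∀ t f x → expect (suc t) f x ≡ average (expect t f) x
    expect-suc t f x = begin
      ∑[ y < m ] ((∑[ z < m ] (P x z * power P t z y)) * f y)
        ≡⟨ sum-cong-≗ (λ y → *-distribʳ-∑ (f y) (λ z → P x z * power P t z y)) ⟩
      ∑[ y < m ] ∑[ z < m ] (P x z * power P t z y * f y)
        ≡⟨ ∑-comm (λ y z → P x z * power P t z y * f y) ⟩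
      ∑[ z < m ] ∑[ y < m ] (P x z * power P t z y * f y)
        ≡⟨ sum-cong-≗ (λ z → sum-cong-≗ (λ y → *-assoc (P x z) (power P t z y) (f y))) ⟩
      ∑[ z < m ] ∑[ y < m ] (P x z * (power P t z y * f y))
        ≡⟨ sum-cong-≗ (λ z → *-distribˡ-∑ (P x z) (λ y → power P t z y * f y)) ⟨
      average (expect t f) x ∎
      where open ≡-Reasoning

    expect-+ : ∀ s t f x → expect (s ℕ.+ t) f x ≡ expect s (expect t f) x
    expect-+ zero    t f x = sym (expect-zero (expect t f) x)
    expect-+ (suc s) t f x = begin
      expect (suc (s ℕ.+ t)) f x          ≡⟨ expect-suc (s ℕ.+ t) f x ⟩
      average (expect (s ℕ.+ t) f) x      ≡⟨ sum-cong-≗ (λ z → cong (P x z *_) (expect-+ s t f z)) ⟩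
      average (expect s (expect t f)) x   ≡⟨ expect-suc s (expect t f) x ⟨
      expect (suc s) (expect t f) x       ∎
      where open ≡-Reasoning

    expect-affine : ∀ t a b f x → expect t (λ z → a + b * f z) x ≡ a + b * expect t f x
    expect-affine zero    a b f x = trans (expect-zero (λ z → a + b * f z) x) (cong (λ e → a + b * e) (sym (expect-zero f x)))
    expect-affine (suc t) a b f x = begin
      expect (suc t) (λ z → a + b * f z) x        ≡⟨ expect-suc t (λ z → a + b * f z) x ⟩
      average (expect t (λ z → a + b * f z)) x    ≡⟨ sum-cong-≗ (λ z → cong (P x z *_) (expect-affine t a b f z)) ⟩
      average (λ z → a + b * expect t f z) x      ≡⟨ average-affine a b (expect t f) x ⟩
      a + b * average (expect t f) x              ≡⟨ cong (λ e → a + b * e) (expect-suc t f x) ⟨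
      a + b * expect (suc t) f x                  ∎
      where open ≡-Reasoning

    0≤power : ∀ t x y → 0ℚ ≤ power P t x y
    0≤power zero    x y = 0≤indicator (x ≟ y)
    0≤power (suc t) x y = 0≤∑ (λ z → 0≤*0≤ (0≤P x z) (0≤power t z y))

    expect-mono : ∀ t {f g} → (∀ z → f z ≤ g z) → ∀ x → expect t f x ≤ expect t g x
    expect-mono t f≤g x = ∑-mono (λ y → *-monoˡ-≤′ (0≤power t x y) (f≤g y))

    power-+ : ∀ s t x z → power P (s ℕ.+ t) x z ≡ ∑[ y < m ] (power P s x y * power P t y z)
    power-+ s t x z = begin
      power P (s ℕ.+ t) x z                    ≡⟨ column (s ℕ.+ t) x ⟨
      expect (s ℕ.+ t) δz x                    ≡⟨ expect-+ s t δz x ⟩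
      expect s (expect t δz) x                 ≡⟨ sum-cong-≗ (λ y → cong (power P s x y *_) (column t y)) ⟩
      expect s (λ y → power P t y z) x         ∎
      where
      open ≡-Reasoning
      δz : Fin m → ℚ
      δz y = indicator (y ≟ z)
      column : ∀ t x → expect t δz x ≡ power P t x z
      column t x = trans (sum-cong-≗ (λ y → *-comm (power P t x y) (δz y))) (∑-indicatorʳ z (power P t x))

    0<power-+ : ∀ s t {x y z} → 0ℚ < power P s x y → 0ℚ < power P t y z → 0ℚ < power P (s ℕ.+ t) x z
    0<power-+ s t {x} {y} {z} 0<Pxy 0<Pyz = subst (0ℚ <_) (sym (power-+ s t x z))
      (0<∑ (λ y → 0≤*0≤ (0≤power s x y) (0≤power t y z)) y (0<*0< 0<Pxy 0<Pyz))

    0<power-1 : ∀ {x y} → 0ℚ < P x y → 0ℚ < power P 1 x y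
    0<power-1 {x} {y} 0<Pxy = subst (0ℚ <_)
      (sym (trans (sum-cong-≗ (λ z → *-comm (P x z) (indicator (z ≟ y)))) (∑-indicatorʳ y (P x)))) 0<Pxy

    measure-power : ∀ t x A → measure (power P t x) A ≡ expect t (λ y → if lookup A y then 1ℚ else 0ℚ) x
    measure-power t x A = sum-cong-≗ (λ y → if-* (lookup A y) (power P t x y))

    -- Induction on t by conditioning on the first step: that step costs at most ε on average, and
    -- the remaining t steps cost at most t · ε from wherever it leads.
    drift : ∀ {ε} f → (∀ x → f x - ε ≤ average f x) → ∀ t x → f x - fromℕ t * ε ≤ expect t f x
    drift {ε} f f-ε≤ zero x = ≤-reflexive (trans (solve 2 (λ f ε → f :- con 0ℚ :* ε := f) refl (f x) ε) (sym (expect-zero f x)))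
    drift {ε} f f-ε≤ (suc t) x = begin
      f x - fromℕ (suc t) * ε
        ≡⟨ cong (λ e → f x - e * ε) (fromℕ-+ 1 t) ⟩
      f x - (1ℚ + fromℕ t) * ε
        ≡⟨ solve 3 (λ f t ε → f :- (con 1ℚ :+ t) :* ε := :- (t :* ε) :+ con 1ℚ :* (f :- ε)) refl (f x) (fromℕ t) ε ⟩
      - (fromℕ t * ε) + 1ℚ * (f x - ε)
        ≤⟨ +-monoʳ-≤ (- (fromℕ t * ε)) (*-monoˡ-≤′ 0≤1 (f-ε≤ x)) ⟩
      - (fromℕ t * ε) + 1ℚ * average f x
        ≡⟨ average-affine (- (fromℕ t * ε)) 1ℚ f x ⟨
      average (λ z → - (fromℕ t * ε) + 1ℚ * f z) x
        ≤⟨ average-mono (λ z → subst (_≤ expect t f z)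
             (solve 2 (λ f e → f :- e := :- e :+ con 1ℚ :* f) refl (f z) (fromℕ t * ε)) (drift f f-ε≤ t z)) x ⟩
      average (expect t f) x
        ≡⟨ expect-suc t f x ⟨
      expect (suc t) f x ∎
      where open ≤-Reasoning

    -- Any enclosing interval is allowed, not only the exact range of f, so that no extrema have to
    -- be computed and the width obeys an exact equation under `contract`.
    record Bracket (f : Fin m → ℚ) (w : ℚ) : Set where
      field
        lo hi : ℚ
        lo≤f  : ∀ x → lo ≤ f x
        f≤hi  : ∀ x → f x ≤ hi
        width : hi - lo ≡ w

    -- Doeblin's contraction: all rows of the N-step matrix put mass at least δ on y₀.
    module _ {N δ y₀} (δ≤power : ∀ x → δ ≤ power P N x y₀) where

      expect-lower : ∀ g → (∀ y → 0ℚ ≤ g y) → ∀ x → δ * g y₀ ≤ expect N g x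
      expect-lower g 0≤g x = begin
        δ * g y₀              ≡⟨ *-comm δ (g y₀) ⟩
        g y₀ * δ              ≤⟨ *-monoˡ-≤′ (0≤g y₀) (δ≤power x) ⟩
        g y₀ * power P N x y₀ ≡⟨ *-comm (g y₀) (power P N x y₀) ⟩
        power P N x y₀ * g y₀ ≤⟨ term≤∑ (λ y → 0≤*0≤ (0≤power N x y) (0≤g y)) y₀ ⟩
        expect N g x          ∎
        where open ≤-Reasoning

      -- Applying `expect-lower` to f - lo and to hi - f moves each end inwards by δ times its
      -- distance from f y₀. These two distances add up to the width.
      contract : ∀ {f w} → Bracket f w → Bracket (expect N f) ((1ℚ - δ) * w)
      contract {f} {w} b = record
        { lo    = lo + δ * (f y₀ - lo)
        ; hi    = hi - δ * (hi - f y₀)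
        ; lo≤f  = λ x → 0≤q-p⇒p≤q (subst (0ℚ ≤_)
            (trans (cong (_- δ * (- lo + 1ℚ * f y₀)) (expect-affine N (- lo) 1ℚ f x))
                   (solve 4 (λ l δ f e → :- l :+ con 1ℚ :* e :- δ :* (:- l :+ con 1ℚ :* f) := e :- (l :+ δ :* (f :- l)))
                     refl lo δ (f y₀) (expect N f x)))
            (p≤q⇒0≤q-p (expect-lower (λ y → - lo + 1ℚ * f y)
               (λ y → subst (0ℚ ≤_) (solve 2 (λ l f → f :- l := :- l :+ con 1ℚ :* f) refl lo (f y)) (p≤q⇒0≤q-p (lo≤f y))) x)))
        ; f≤hi  = λ x → 0≤q-p⇒p≤q (subst (0ℚ ≤_)
            (trans (cong (_- δ * (hi + (- 1ℚ) * f y₀)) (expect-affine N hi (- 1ℚ) f x))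
                   (solve 4 (λ h δ f e → h :+ (:- con 1ℚ) :* e :- δ :* (h :+ (:- con 1ℚ) :* f) := (h :- δ :* (h :- f)) :- e)
                     refl hi δ (f y₀) (expect N f x)))
            (p≤q⇒0≤q-p (expect-lower (λ y → hi + (- 1ℚ) * f y)
               (λ y → subst (0ℚ ≤_) (solve 2 (λ h f → h :- f := h :+ (:- con 1ℚ) :* f) refl hi (f y)) (p≤q⇒0≤q-p (f≤hi y))) x)))
        ; width = trans (solve 4 (λ h l δ f → (h :- δ :* (h :- f)) :- (l :+ δ :* (f :- l)) := (con 1ℚ :- δ) :* (h :- l))
                   refl hi lo δ (f y₀))
                        (cong ((1ℚ - δ) *_) width)
        }
        where open Bracket b

      -- The decay (1 - δ)^s is recorded only through the weaker bound w ≤ 1/(1 + sδ), written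
      -- without division. It suffices for convergence and avoids powers. The induction step is (1 -
      -- δ)(1 + (s+1)δ) ≤ 1 + sδ.
      iterate : ∀ {f} → 0ℚ ≤ δ → δ ≤ 1ℚ → Bracket f 1ℚ → ∀ s →
                ∃[ w ] (0ℚ ≤ w × w * (1ℚ + fromℕ s * δ) ≤ 1ℚ × Bracket (expect (s ℕ.* N) f) w)
      iterate {f} 0≤δ δ≤1 b zero = 1ℚ , 0≤1 ,
        ≤-reflexive (solve 1 (λ δ → con 1ℚ :* (con 1ℚ :+ con 0ℚ :* δ) := con 1ℚ) refl δ) , record
        { lo = lo ; hi = hi ; width = width
        ; lo≤f = λ x → subst (lo ≤_) (sym (expect-zero f x)) (lo≤f x)
        ; f≤hi = λ x → subst (_≤ hi) (sym (expect-zero f x)) (f≤hi x) }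
        where open Bracket b
      iterate {f} 0≤δ δ≤1 b (suc s) with iterate 0≤δ δ≤1 b s
      ... | w , 0≤w , w≤ , b′ = (1ℚ - δ) * w , 0≤*0≤ (p≤q⇒0≤q-p δ≤1) 0≤w , bound , record
        { lo = lo ; hi = hi ; width = width
        ; lo≤f = λ x → subst (lo ≤_) (sym (expect-+ N (s ℕ.* N) f x)) (lo≤f x)
        ; f≤hi = λ x → subst (_≤ hi) (sym (expect-+ N (s ℕ.* N) f x)) (f≤hi x) }
        where
        open Bracket (contract b′)
        open ≤-Reasoning
        a = fromℕ s * δ
        bound : (1ℚ - δ) * w * (1ℚ + fromℕ (suc s) * δ) ≤ 1ℚ
        bound = begin
          (1ℚ - δ) * w * (1ℚ + fromℕ (suc s) * δ)    ≡⟨ cong (λ e → (1ℚ - δ) * w * (1ℚ + e * δ)) (fromℕ-+ 1 s) ⟩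
          (1ℚ - δ) * w * (1ℚ + (1ℚ + fromℕ s) * δ)   ≡⟨ solve 3 (λ δ w s → (con 1ℚ :- δ) :* w :* (con 1ℚ :+ (con 1ℚ :+ s) :* δ)
                                                             := w :* (con 1ℚ :+ s :* δ) :- w :* (δ :* (δ :+ s :* δ)))
                                                                refl δ w (fromℕ s) ⟩
          w * (1ℚ + a) - w * (δ * (δ + a))           ≤⟨ +-monoʳ-≤ (w * (1ℚ + a))
                                                           (neg-antimono-≤ (0≤*0≤ 0≤w (0≤*0≤ 0≤δ (0≤+0≤ 0≤δ (0≤*0≤ (0≤fromℕ s) 0≤δ))))) ⟩
          w * (1ℚ + a) - 0ℚ                          ≡⟨ +-identityʳ _ ⟩
          w * (1ℚ + a)                               ≤⟨ w≤ ⟩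
          1ℚ                                         ∎

    distanceAt-≥ : ∀ π t x A → measure (power P t x) A - measure π A ≤ distanceAt P π t
    distanceAt-≥ π t x A = begin
      measure (power P t x) A - measure π A        ≤⟨ p≤∣p∣ _ ⟩
      ∣ measure (power P t x) A - measure π A ∣    ≤⟨ ≤-maximum (∈-map⁺ _ (∈-allVecs _ bits m A)) ⟩
      tvDistance (power P t x) π                   ≤⟨ ≤-maximum (∈-map⁺ (λ x → tvDistance (power P t x) π) (∈-allFin x)) ⟩
      distanceAt P π t                             ∎
      where
      open ≤-Reasoning
      bits : ∀ b → b ∈ (inside ∷ outside ∷ [])
      bits true  = here refl
      bits false = there (here refl)

    distanceAt-≤ : ∀ π t {c} → 0ℚ ≤ c → (∀ x A → ∣ measure (power P t x) A - measure π A ∣ ≤ c) → distanceAt P π t ≤ c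
    distanceAt-≤ π t {c} 0≤c ≤c = maximum-≤ _ 0≤c λ x∈ → rows (∈-map⁻ _ x∈)
      where
      events : ∀ x {q} → ∃[ A ] (A ∈ allVecs (inside ∷ outside ∷ []) m × q ≡ ∣ measure (power P t x) A - measure π A ∣) → q ≤ c
      events x (A , _ , refl) = ≤c x A
      rows : ∀ {q} → ∃[ x ] (x ∈ allFin m × q ≡ tvDistance (power P t x) π) → q ≤ c
      rows (x , _ , refl) = maximum-≤ _ 0≤c λ A∈ → events x (∈-map⁻ _ A∈)

    module _ (loop : ∀ x → 0ℚ < P x x) where

      0<power-loop : ∀ t x → 0ℚ < power P t x x
      0<power-loop zero    x = subst (0ℚ <_) (sym (indicator-yes (x ≟ x) refl)) 0<1
      0<power-loop (suc t) x = 0<power-+ 1 t (0<power-1 (loop x)) (0<power-loop t x)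

      aperiodic : IsAperiodic P
      aperiodic x d d∣ = ∣1⇒≡1 (d∣ 1 (ℕ.s≤s ℕ.z≤n) (0<power-loop 1 x))

      module _ (irreducible : IsIrreducible P) {π} (stationary : IsStationary P π) (x₀ : Fin m) where

        upper : ∀ {n} (t : Fin n → ℕ) → ∃[ N ] (∀ i → t i ℕ.≤ N)
        upper {zero}  t = 0 , λ ()
        upper {suc n} t with upper (λ i → t (suc i))
        ... | N , t≤N = t zero ℕ.⊔ N , λ where
          zero    → ℕ.m≤m⊔n (t zero) N
          (suc i) → ℕ.≤-trans (t≤N i) (ℕ.m≤n⊔m (t zero) N)

        positiveLower : ∀ {n} (f : Fin n → ℚ) → (∀ i → 0ℚ < f i) → ∃[ δ ] (0ℚ < δ × δ ≤ 1ℚ × (∀ i → δ ≤ f i))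
        -- Starting the minimum at 1 also delivers δ ≤ 1, which `iterate` needs to keep the widths
        -- non-negative.
        positiveLower {zero}  f 0<f = 1ℚ , 0<1 , ≤-refl , λ ()
        positiveLower {suc n} f 0<f with positiveLower (λ i → f (suc i)) (λ i → 0<f (suc i))
        ... | δ , 0<δ , δ≤1 , δ≤f with ≤-total (f zero) δ
        ...   | inj₁ f0≤δ = f zero , 0<f zero , ≤-trans f0≤δ δ≤1 , λ where
          zero    → ≤-refl
          (suc i) → ≤-trans f0≤δ (δ≤f i)
        ...   | inj₂ δ≤f0 = δ , 0<δ , δ≤1 , λ where
          zero    → δ≤f0
          (suc i) → δ≤f i

        -- Invariance of π under t steps, in a form that exhibits π(A) as a π-average of the
        -- probabilities of A after t steps. Hence π(A) lies in every bracket of those.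
        measure-stationary : ∀ t A → measure π A ≡ ∑[ x < m ] (π x * expect t (λ y → if lookup A y then 1ℚ else 0ℚ) x)
        measure-stationary zero A = sum-cong-≗ (λ x → trans (if-* (lookup A x) (π x)) (cong (π x *_) (sym (expect-zero _ x))))
        measure-stationary (suc t) A = begin
          measure π A                                             ≡⟨ measure-stationary t A ⟩
          ∑[ z < m ] (π z * h z)                                  ≡⟨ sum-cong-≗ (λ z → cong (_* h z) (proj₂ stationary z)) ⟨
          ∑[ z < m ] ((∑[ x < m ] (π x * P x z)) * h z)           ≡⟨ sum-cong-≗ (λ z → *-distribʳ-∑ (h z) (λ x → π x * P x z)) ⟩
          ∑[ z < m ] ∑[ x < m ] (π x * P x z * h z)               ≡⟨ ∑-comm (λ z x → π x * P x z * h z) ⟩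
          ∑[ x < m ] ∑[ z < m ] (π x * P x z * h z)               ≡⟨ sum-cong-≗
              (λ x → sum-cong-≗ (λ z → *-assoc (π x) (P x z) (h z))) ⟩
          ∑[ x < m ] ∑[ z < m ] (π x * (P x z * h z))             ≡⟨ sum-cong-≗ (λ x → *-distribˡ-∑ (π x) (λ z → P x z * h z)) ⟨
          ∑[ x < m ] (π x * average h x)                          ≡⟨ sum-cong-≗ (λ x → cong (π x *_) (expect-suc t _ x)) ⟨
          ∑[ x < m ] (π x * expect (suc t) _ x)                   ∎
          where
          open ≡-Reasoning
          h : Fin m → ℚ
          h = expect t (λ y → if lookup A y then 1ℚ else 0ℚ)

        ∑π-const : ∀ c → ∑[ x < m ] (π x * c) ≡ c
        ∑π-const c = trans (sym (*-distribʳ-∑ c π)) (trans (cong (_* c) (proj₂ (proj₁ stationary))) (*-identityˡ c))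

        -- A mixing time is a least element, so some mixed time has to be exhibited first. The
        -- bracket of an event at time T contains both quantities being compared, so their
        -- difference is at most its width.
        convergence : ∃[ T ] (distanceAt P π T ≤ + 1 / 4)
        convergence with upper (λ x → proj₁ (irreducible x x₀))
        -- Each x reaches x₀ within N steps and can spend the remaining ones in the loop at x₀. So
        -- the column of x₀ in the N-step matrix is positive, and δ is a lower bound for it.
        ... | N , t≤N with positiveLower (λ x → power P N x x₀)
              (λ x → subst (λ t → 0ℚ < power P t x x₀) (ℕ.m+[n∸m]≡n (t≤N x))
                (0<power-+ (proj₁ (irreducible x x₀)) (N ℕ.∸ proj₁ (irreducible x x₀)) (proj₂ (irreducible x x₀))
                   (0<power-loop (N ℕ.∸ proj₁ (irreducible x x₀)) x₀)))
        ... | δ , 0<δ , δ≤1 , δ≤P with archimedean 0<δ 3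
        -- With sδ ≥ 3 the bound w(1 + sδ) ≤ 1 becomes w ≤ 1/4.
        ... | s , 3≤sδ = T , distanceAt-≤ π T (*≤* (ℤ.+≤+ ℕ.z≤n)) close
          where
          T = s ℕ.* N
          close : ∀ x A → ∣ measure (power P T x) A - measure π A ∣ ≤ + 1 / 4
          close x A with iterate δ≤P (<⇒≤ 0<δ) δ≤1 bracket₀ s
            where
            bracket₀ : Bracket (λ y → if lookup A y then 1ℚ else 0ℚ) 1ℚ
            bracket₀ = record
              { lo = 0ℚ ; hi = 1ℚ ; width = refl
              ; lo≤f = λ y → lo≤ (lookup A y) ; f≤hi = λ y → ≤hi (lookup A y) }
              where
              lo≤ : ∀ b → 0ℚ ≤ (if b then 1ℚ else 0ℚ)
              lo≤ true  = 0≤1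
              lo≤ false = ≤-refl
              ≤hi : ∀ b → (if b then 1ℚ else 0ℚ) ≤ 1ℚ
              ≤hi true  = ≤-refl
              ≤hi false = 0≤1
          ... | w , 0≤w , w≤ , b = ∣-∣≤ (≤-trans upper-diff w≤¼) (≤-trans (neg-antimono-≤ w≤¼) lower-diff)
            where
            open Bracket b
            open ≤-Reasoning
            0≤π = proj₁ (proj₁ stationary)
            w≤¼ : w ≤ + 1 / 4
            w≤¼ = *-cancelʳ-≤-pos (fromℕ 4) (begin
              w * fromℕ 4                   ≤⟨ *-monoˡ-≤′ 0≤w (+-monoʳ-≤ 1ℚ 3≤sδ) ⟩
              w * (1ℚ + fromℕ s * δ)        ≤⟨ w≤ ⟩
              1ℚ                            ∎)
            lo≤π : lo ≤ measure π A
            lo≤π = begin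
              lo                            ≡⟨ ∑π-const lo ⟨
              ∑[ x < m ] (π x * lo)         ≤⟨ ∑-mono (λ x → *-monoˡ-≤′ (0≤π x) (lo≤f x)) ⟩
              _                             ≡⟨ measure-stationary T A ⟨
              measure π A                   ∎
            π≤hi : measure π A ≤ hi
            π≤hi = begin
              measure π A                   ≡⟨ measure-stationary T A ⟩
              _                             ≤⟨ ∑-mono (λ x → *-monoˡ-≤′ (0≤π x) (f≤hi x)) ⟩
              ∑[ x < m ] (π x * hi)         ≡⟨ ∑π-const hi ⟩
              hi                            ∎
            upper-diff : measure (power P T x) A - measure π A ≤ w
            upper-diff = begin
              measure (power P T x) A - measure π A   ≤⟨ +-mono-≤ (subst (_≤ hi) (sym (measure-power T x A)) (f≤hi x))
                                                          (neg-antimono-≤ lo≤π) ⟩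
              hi - lo                                 ≡⟨ width ⟩
              w                                       ∎
            lower-diff : - w ≤ measure (power P T x) A - measure π A
            lower-diff = begin
              - w                                     ≡⟨ cong -_ width ⟨
              - (hi - lo)                             ≡⟨ solve 2 (λ h l → :- (h :- l) := l :- h) refl hi lo ⟩
              lo - hi                                 ≤⟨ +-mono-≤ (subst (lo ≤_) (sym (measure-power T x A)) (lo≤f x))
                                                          (neg-antimono-≤ π≤hi) ⟩
              measure (power P T x) A - measure π A   ∎

        Mixed : ℕ → Set
        Mixed t = distanceAt P π t ≤ + 1 / 4

        -- `Mixed τ` is returned beside the record because the record hides its stationary
        -- distribution, whereas the lower bound is to be applied to the given π. Minimality comes
        -- from well-founded descent: as long as an earlier mixed time exists, restart from it.
        mixingTime : ∃[ τ ] (Mixed τ × IsMixingTime P τ)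
        mixingTime = search (proj₁ convergence) (proj₂ convergence)
          where
          search : ∀ T → Mixed T → ∃[ τ ] (Mixed τ × IsMixingTime P τ)
          search = <-rec _ λ T rec mixed → case ℕ.anyUpTo? (λ t → distanceAt P π t ≤? + 1 / 4) T of λ where
            (yes (t , t<T , mixed′)) → rec t<T mixed′
            (no none) → T , mixed , record
              { π = π ; stationary = stationary ; mixed = mixed
              ; least = λ t mixed′ → ℕ.≮⇒≥ (λ t<T → none (t , t<T , mixed′)) }

-- Single-vertex recolourings and the Glauber chain

module GlauberDynamics where

  open import Data.Fin.Permutation using (permutation)
  open import Data.Fin.Subset using (Subset)
  open import Data.List.Base as List using (List; []; _∷_; allFin)
  open import Data.List.Membership.Propositional using (_∈_)
  open import Data.List.Membership.Propositional.Properties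
    using (∈-allFin; ∈-filter⁺; ∈-filter⁻; ∈-lookup)
  import Data.List.Relation.Unary.All as All
  import Data.List.Relation.Unary.Any as Any
  import Data.List.Relation.Unary.Any.Properties as Any
  open import Data.List.Relation.Unary.AllPairs using ([]; _∷_)
  open import Data.List.Relation.Unary.Unique.Propositional using (Unique)
  import Data.List.Relation.Unary.Unique.Propositional.Properties as Unique
  open import Data.Vec.Base as Vec using (Vec; lookup; _[_]≔_)
  open import Data.Rational.Base
  open import Data.Rational.Properties hiding (_≟_)
  open import Data.Rational.Solver
  open import Algebra.Properties.CommutativeMonoid.Sum +-0-commutativeMonoid
  open import Relation.Binary.Construct.Closure.ReflexiveTransitive using (Star; ε; _◅_)
  open RationalSums
  open MarkovChains
  open +-*-Solver

  allVecs-unique : ∀ {A : Set} {xs : List A} → Unique xs → ∀ n → Unique (allVecs xs n)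
  allVecs-unique xs! zero    = All.[] ∷ []
  allVecs-unique xs! (suc n) = Unique.cartesianProductWith⁺ Vec._∷_ ∷-injective xs! (allVecs-unique xs! n)

  lookup-injective : ∀ {A : Set} {xs : List A} → Unique xs → ∀ {i j} → List.lookup xs i ≡ List.lookup xs j → i ≡ j
  lookup-injective (_  ∷ _)   {zero}  {zero}  eq = refl
  lookup-injective (x∉ ∷ _)   {zero}  {suc j} eq = contradiction eq (All.lookup x∉ (∈-lookup j))
  lookup-injective (x∉ ∷ _)   {suc i} {zero}  eq = contradiction (sym eq) (All.lookup x∉ (∈-lookup i))
  lookup-injective (_  ∷ xs!) {suc i} {suc j} eq = cong suc (lookup-injective xs! eq)

  -- A and its preimage under φ are disjoint and have equal uniform mass.
  measure≤½ : ∀ {m} (A : Subset m) (φ : Fin m → Fin m) → (∀ x → φ (φ x) ≡ x) →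
              (∀ x → lookup A x ≡ true → lookup A (φ x) ≡ false) → Fin m → measure uniform A ≤ ½
  measure≤½ {m} A φ φφ≡id disjoint x₀ = *-cancelˡ-≤-pos (fromℕ 2) (begin
    fromℕ 2 * measure uniform A
      ≡⟨ solve 1 (λ a → con (fromℕ 2) :* a := a :+ a) refl (measure uniform A) ⟩
    measure uniform A + measure uniform A
      ≡⟨ cong (λ z → measure uniform A + z) (sum-permute mass (permutation φ φ φφ≡id φφ≡id)) ⟩
    measure uniform A + ∑[ x < m ] mass (φ x)
      ≡⟨ ∑-distrib-+ mass (λ x → mass (φ x)) ⟨
    ∑[ x < m ] (mass x + mass (φ x))
      ≤⟨ ∑-mono (λ x → pair x (lookup A x) (lookup A (φ x)) refl refl) ⟩
    ∑[ x < m ] uniform x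
      ≡⟨ ∑-uniform x₀ ⟩
    1ℚ ∎)
    where
    open ≤-Reasoning
    mass : Fin m → ℚ
    mass x = if lookup A x then uniform x else 0ℚ
    pair : ∀ x a b → lookup A x ≡ a → lookup A (φ x) ≡ b →
           (if a then uniform x else 0ℚ) + (if b then uniform (φ x) else 0ℚ) ≤ uniform x
    pair x true  true  Ax Aφx with trans (sym Aφx) (disjoint x Ax)
    ... | ()
    pair x true  false _  _ = ≤-reflexive (+-identityʳ (uniform x))
    pair x false true  _  _ = ≤-reflexive (trans (+-identityˡ (uniform (φ x))) (uniform-const (φ x) x))
    pair x false false _  _ = 0≤uniform x

  module Moves {n} (G : Graph n) {q : ℕ} where
    open Graph G using (Adj) renaming (sym to Adj-sym; irrefl to Adj-irrefl)

    Move : Colouring q n → Colouring q n → Set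
    Move α β = ∃[ v ] ∃[ c ] (¬ Appears G α v c × β ≡ α [ v ]≔ c)

    -- Decidability over the finite sets of vertices and colours turns the negated universal
    -- statement into a witness.
    unfrozen : ∀ {α : Colouring q n} → ¬ Frozen G α → ∃[ v ] ∃[ c ] (¬ Appears G α v c × lookup α v ≢ c)
    unfrozen {α} ¬frozen =
      let sees?    = λ v c → any? λ u → ((u ≟ v) ⊎-dec Graph.adj? G v u) ×-dec (lookup α u ≟ c)
          v , ¬all  = ¬∀⟶∃¬ n _ (λ v → all? (sees? v)) ¬frozen
          c , ¬seen = ¬∀⟶∃¬ q _ (sees? v) ¬all
      in v , c , (λ (u , v~u , eq) → ¬seen (u , inj₂ v~u , eq)) , λ eq → ¬seen (v , inj₁ refl , eq)

    nonFrozen-witness : ∀ {α : Colouring q n} {v c} → ¬ Appears G α v c → lookup α v ≢ c → ¬ Frozen G α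
    nonFrozen-witness {α} {v} {c} ∄u αv≢c frozen with frozen v c
    ... | u , inj₁ refl , eq = αv≢c eq
    ... | u , inj₂ v~u  , eq = ∄u (u , v~u , eq)

    module _ {σ : Fin q → Fin q} (σσ≡id : ∀ c → σ (σ c) ≡ c) where

      private
        σ-injective : ∀ {a b} → σ a ≡ σ b → a ≡ b
        σ-injective {a} {b} eq = trans (sym (σσ≡id a)) (trans (cong σ eq) (σσ≡id b))

      map-proper : ∀ (α : Colouring q n) → Proper G α → Proper G (Vec.map σ α)
      map-proper α proper x y x~y eq = proper x y x~y
        (σ-injective (trans (sym (lookup-map x σ α)) (trans eq (lookup-map y σ α))))

      map-nonFrozen : ∀ (α : Colouring q n) → ¬ Frozen G α → ¬ Frozen G (Vec.map σ α)
      map-nonFrozen α ¬frozen frozen = ¬frozen λ v c → let u , near , eq = frozen v (σ c) in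
        u , near , σ-injective (trans (sym (lookup-map u σ α)) eq)

      map-involutive : ∀ (α : Colouring q n) → Vec.map σ (Vec.map σ α) ≡ α
      map-involutive α = trans (sym (map-∘ σ σ α)) (trans (map-cong σσ≡id α) (map-id α))

    step-cases : ∀ (α : Colouring q n) v c → (¬ Appears G α v c × glauberStep G α v c ≡ α [ v ]≔ c) ⊎ (glauberStep G α v c ≡ α)
    step-cases α v c with appears? G α v c
    ... | yes _ = inj₂ refl
    ... | no ∄u = inj₁ (∄u , refl)

    step-absent : ∀ (α : Colouring q n) v c → ¬ Appears G α v c → glauberStep G α v c ≡ α [ v ]≔ c
    step-absent α v c ∄u rewrite dec-false (appears? G α v c) ∄u = refl

    step-own : ∀ (α : Colouring q n) v → glauberStep G α v (lookup α v) ≡ α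
    step-own α v with step-cases α v (lookup α v)
    ... | inj₁ (_ , eq) = trans eq ([]≔-lookup α v)
    ... | inj₂ eq       = eq

    neighbour≢ : ∀ {v u} → Adj v u → u ≢ v
    neighbour≢ v~u u≡v = Adj-irrefl (sym u≡v) v~u

    own-absent : ∀ (α : Colouring q n) → Proper G α → ∀ v c → ¬ Appears G (α [ v ]≔ c) v (lookup α v)
    own-absent α proper v c (u , v~u , eq) =
      proper v u v~u (sym (trans (sym (lookup∘update′ (neighbour≢ v~u) α c)) eq))

    -- Since α is proper, the old colour of v is on no neighbour, and the move has not touched the
    -- neighbours; so v may take it back.
    move-sym : ∀ {α β} → Proper G α → Move α β → Move β α
    move-sym {α} proper (v , c , ∄u , refl) = v , lookup α v , own-absent α proper v c ,
      sym (trans ([]≔-idempotent α v) ([]≔-lookup α v))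

    move-proper : ∀ {α β} → Move α β → Proper G α → Proper G β
    move-proper {α} (v , c , ∄u , refl) proper x y x~y with x ≟ v | y ≟ v
    ... | yes refl | _ = λ eq → ∄u (y , x~y ,
      trans (sym (lookup∘update′ (neighbour≢ x~y) α c)) (trans (sym eq) (lookup∘update x α c)))
    ... | no _ | yes refl = λ eq → ∄u (x , Adj-sym x~y ,
      trans (sym (lookup∘update′ (neighbour≢ (Adj-sym x~y)) α c)) (trans eq (lookup∘update y α c)))
    ... | no x≢v | no y≢v = λ eq → proper x y x~y
      (trans (sym (lookup∘update′ x≢v α c)) (trans eq (lookup∘update′ y≢v α c)))

    -- A move that really changes v leaves its old colour absent from the closed neighbourhood of v,
    -- which witnesses that the new colouring is not frozen.
    move-nonFrozen : ∀ {α β} → Move α β → Proper G α → ¬ Frozen G α → ¬ Frozen G β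
    move-nonFrozen {α} (v , c , ∄u , refl) proper ¬frozen frozen with lookup α v ≟ c
    ... | yes refl = ¬frozen (subst (Frozen G) ([]≔-lookup α v) frozen)
    ... | no αv≢c with frozen v (lookup α v)
    ...   | u , inj₁ refl , eq = αv≢c (trans (sym eq) (lookup∘update v α c))
    ...   | u , inj₂ v~u  , eq = own-absent α proper v c (u , v~u , eq)

    star-proper : ∀ {α β} → Star Move α β → Proper G α → Proper G β
    star-proper ε        proper = proper
    star-proper (m ◅ ms) proper = star-proper ms (move-proper m proper)

    star-nonFrozen : ∀ {α β} → Star Move α β → Proper G α → ¬ Frozen G α → ¬ Frozen G β
    star-nonFrozen ε        proper ¬frozen = ¬frozen
    star-nonFrozen (m ◅ ms) proper ¬frozen = star-nonFrozen ms (move-proper m proper) (move-nonFrozen m proper ¬frozen)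

    -- A step that changes the colouring does recolour v, so c can be read off from β, and choosing
    -- v with its old colour undoes the step.
    step-reverse : ∀ (α {β} : Colouring q n) → Proper G α → α ≢ β → ∀ v c → glauberStep G α v c ≡ β →
                   c ≡ lookup β v × glauberStep G β v (lookup α v) ≡ α
    step-reverse α proper α≢β v c refl with step-cases α v c
    ... | inj₂ eq = contradiction (sym eq) α≢β
    ... | inj₁ (_ , eq) rewrite eq = sym (lookup∘update v α c) ,
      trans (step-absent (α [ v ]≔ c) v (lookup α v) (own-absent α proper v c))
            (trans ([]≔-idempotent α v) ([]≔-lookup α v))

  -- The chain restricted to non-frozen colourings: stochastic, symmetric, ergodic

  module NonFrozenChain {n} (G : Graph n) {q : ℕ} (v₀ : Fin n) (c₀ : Fin q) where
    open Moves G {q}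

    states : List (Colouring q n)
    states = nonFrozenColourings G q

    State : Set
    State = Fin (List.length states)

    P : Matrix (List.length states)
    P = nonFrozenGlauber G q

    colouring : State → Colouring q n
    colouring = List.lookup states

    -- States are positions in a list, so they correspond to colourings faithfully only because the
    -- enumeration has no repetitions.
    colouring-injective : ∀ {x y} → colouring x ≡ colouring y → x ≡ y
    colouring-injective = lookup-injective
      (Unique.filter⁺ _ (Unique.filter⁺ (proper? G) (allVecs-unique (Unique.allFin⁺ q) n)))

    private
      member : ∀ x → colouring x ∈ properColourings G q × ¬ Frozen G (colouring x)
      member x = ∈-filter⁻ _ (∈-lookup {xs = states} x)

    proper : ∀ x → Proper G (colouring x)
    proper x = proj₂ (∈-filter⁻ (proper? G) {xs = allVecs (allFin q) n} (proj₁ (member x)))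

    nonFrozen : ∀ x → ¬ Frozen G (colouring x)
    nonFrozen x = proj₂ (member x)

    state : ∀ α → Proper G α → ¬ Frozen G α → ∃[ x ] colouring x ≡ α
    state α αproper ¬frozen = Any.index α∈ , sym (Any.lookup-index α∈)
      where
      α∈ : α ∈ states
      α∈ = ∈-filter⁺ _ (∈-filter⁺ (proper? G) (∈-allVecs (allFin q) ∈-allFin n α) αproper) ¬frozen

    private
      -- The non-frozen proper colourings are closed under the dynamics. Thus no probability leaks
      -- out of the restricted matrix.
      next : ∀ x v c → ∃[ y ] colouring y ≡ glauberStep G (colouring x) v c
      next x v c with step-cases (colouring x) v c
      ... | inj₂ eq        = x , sym eq
      ... | inj₁ (∄u , eq) = subst (λ β → ∃[ y ] colouring y ≡ β) (sym eq)
        (state (colouring x [ v ]≔ c) (move-proper {colouring x} (v , c , ∄u , refl) (proper x))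
          (move-nonFrozen {colouring x} (v , c , ∄u , refl) (proper x) (nonFrozen x)))

    step : State → Fin n → Fin q → State
    step x v c = proj₁ (next x v c)

    colouring-step : ∀ x v c → colouring (step x v c) ≡ glauberStep G (colouring x) v c
    colouring-step x v c = proj₂ (next x v c)

    weight : Fin n → Fin q → ℚ
    weight v c = uniform v * uniform c

    0≤weight : ∀ v c → 0ℚ ≤ weight v c
    0≤weight v c = 0≤*0≤ (0≤uniform v) (0≤uniform c)

    ∑weight : ∑[ v < n ] ∑[ c < q ] weight v c ≡ 1ℚ
    ∑weight = begin
      ∑[ v < n ] ∑[ c < q ] weight v c              ≡⟨ sum-cong-≗ {n} (λ v → *-distribˡ-∑ {q} (uniform v) uniform) ⟨
      ∑[ v < n ] (uniform v * ∑[ c < q ] uniform c) ≡⟨ *-distribʳ-∑ {n} (∑[ c < q ] uniform c) uniform ⟨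
      (∑[ v < n ] uniform v) * ∑[ c < q ] uniform c ≡⟨ cong₂ _*_ (∑-uniform v₀) (∑-uniform c₀) ⟩
      1ℚ                                            ∎
      where open ≡-Reasoning

    P≡ : ∀ x y → P x y ≡ ∑[ v < n ] ∑[ c < q ] (weight v c * indicator (step x v c ≟ y))
    P≡ x y = sum-cong-≗ λ v → sum-cong-≗ λ c → cong (weight v c *_)
      (indicator-cong (≡-dec _≟_ (glauberStep G (colouring x) v c) (colouring y)) (step x v c ≟ y)
        (λ eq → colouring-injective (trans (colouring-step x v c) eq))
        (λ { refl → sym (colouring-step x v c) }))

    -- Exchanging sums turns an average over target states into one over the choices of a vertex and
    -- a colour, the form in which stochasticity and drift are computed.
    P-average : ∀ f x → ∑[ y < List.length states ] (P x y * f y) ≡ ∑[ v < n ] ∑[ c < q ] (weight v c * f (step x v c))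
    P-average f x = begin
      ∑[ y < _ ] (P x y * f y)
        ≡⟨ sum-cong-≗ (λ y → cong (_* f y) (P≡ x y)) ⟩
      ∑[ y < _ ] ((∑[ v < n ] ∑[ c < q ] (weight v c * δ v c y)) * f y)
        ≡⟨ sum-cong-≗ (λ y → *-distribʳ-∑ (f y) (λ v → ∑[ c < q ] (weight v c * δ v c y))) ⟩
      ∑[ y < _ ] ∑[ v < n ] ((∑[ c < q ] (weight v c * δ v c y)) * f y)
        ≡⟨ ∑-comm (λ y v → (∑[ c < q ] (weight v c * δ v c y)) * f y) ⟩
      ∑[ v < n ] ∑[ y < _ ] ((∑[ c < q ] (weight v c * δ v c y)) * f y)
        ≡⟨ sum-cong-≗ (λ v → sum-cong-≗ (λ y → *-distribʳ-∑ (f y) (λ c → weight v c * δ v c y))) ⟩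
      ∑[ v < n ] ∑[ y < _ ] ∑[ c < q ] (weight v c * δ v c y * f y)
        ≡⟨ sum-cong-≗ (λ v → ∑-comm (λ y c → weight v c * δ v c y * f y)) ⟩
      ∑[ v < n ] ∑[ c < q ] ∑[ y < _ ] (weight v c * δ v c y * f y)
        ≡⟨ sum-cong-≗ (λ v → sum-cong-≗ (λ c → sum-cong-≗ (λ y → *-assoc (weight v c) (δ v c y) (f y)))) ⟩
      ∑[ v < n ] ∑[ c < q ] ∑[ y < _ ] (weight v c * (δ v c y * f y))
        ≡⟨ sum-cong-≗ (λ v → sum-cong-≗ (λ c → *-distribˡ-∑ (weight v c) (λ y → δ v c y * f y))) ⟨
      ∑[ v < n ] ∑[ c < q ] (weight v c * ∑[ y < _ ] (δ v c y * f y))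
        ≡⟨ sum-cong-≗ (λ v → sum-cong-≗ (λ c → cong (weight v c *_) (∑-indicator (step x v c) f))) ⟩
      ∑[ v < n ] ∑[ c < q ] (weight v c * f (step x v c)) ∎
      where
      open ≡-Reasoning
      δ : Fin n → Fin q → State → ℚ
      δ v c y = indicator (step x v c ≟ y)

    stochastic : IsStochastic P
    stochastic x = (λ y → subst (0ℚ ≤_) (sym (P≡ x y))
        (0≤∑ λ v → 0≤∑ λ c → 0≤*0≤ (0≤weight v c) (0≤indicator (step x v c ≟ y)))) , (begin
      ∑[ y < _ ] P x y                          ≡⟨ sum-cong-≗ (λ y → *-identityʳ (P x y)) ⟨
      ∑[ y < _ ] (P x y * 1ℚ)                   ≡⟨ P-average (λ _ → 1ℚ) x ⟩
      ∑[ v < n ] ∑[ c < q ] (weight v c * 1ℚ)   ≡⟨ sum-cong-≗ (λ v → sum-cong-≗ (λ c → *-identityʳ (weight v c))) ⟩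
      ∑[ v < n ] ∑[ c < q ] weight v c          ≡⟨ ∑weight ⟩
      1ℚ                                        ∎)
      where open ≡-Reasoning

    open Chain P stochastic

    0<P-step : ∀ x v c → 0ℚ < P x (step x v c)
    0<P-step x v c = subst (0ℚ <_) (sym (P≡ x (step x v c)))
      (0<∑ (λ v′ → 0≤∑ λ c′ → 0≤term v′ c′) v (0<∑ (0≤term v) c
        (subst (λ e → 0ℚ < weight v c * e) (sym (indicator-yes (step x v c ≟ step x v c) refl))
          (0<*0< (0<*0< (0<uniform v) (0<uniform c)) 0<1))))
      where
      0≤term : ∀ v′ c′ → 0ℚ ≤ weight v′ c′ * indicator (step x v′ c′ ≟ step x v c)
      0≤term v′ c′ = 0≤*0≤ (0≤weight v′ c′) (0≤indicator (step x v′ c′ ≟ step x v c))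

    -- Choosing the colour that the vertex already has leaves the colouring as it is.
    loop : ∀ x → 0ℚ < P x x
    loop x = subst (λ y → 0ℚ < P x y)
      (colouring-injective (trans (colouring-step x v₀ (lookup (colouring x) v₀)) (step-own (colouring x) v₀)))
      (0<P-step x v₀ (lookup (colouring x) v₀))

    0<power-star : ∀ {α β} → Star Move α β → ∀ x y → colouring x ≡ α → colouring y ≡ β → ∃[ t ] 0ℚ < power P t x y
    0<power-star ε x y refl eq with colouring-injective eq
    ... | refl = 0 , 0<power-loop loop 0 x
    0<power-star ((v , c , ∄u , refl) ◅ ms) x y refl eq =
      let t , 0<P = 0<power-star ms (step x v c) y (trans (colouring-step x v c) (step-absent (colouring x) v c ∄u)) eq
      in suc t , 0<power-+ 1 t (0<power-1 (0<P-step x v c)) 0<P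

    Recolours : State → State → Fin n → Set
    Recolours x y v = glauberStep G (colouring x) v (lookup (colouring y) v) ≡ colouring y

    recolours? : ∀ x y v → Dec (Recolours x y v)
    recolours? x y v = ≡-dec _≟_ (glauberStep G (colouring x) v (lookup (colouring y) v)) (colouring y)

    recolours-sym : ∀ {x y} v → x ≢ y → Recolours x y v → Recolours y x v
    recolours-sym {x} {y} v x≢y eq =
      proj₂ (step-reverse (colouring x) (proper x) (λ eq′ → x≢y (colouring-injective eq′)) v (lookup (colouring y) v) eq)

    -- When x ≢ y, the choice of v can lead to y only together with the colour of v in y, so the sum
    -- over c collapses to one term. All weights are equal, whence the fixed `c₀`. What remains is
    -- symmetric in x and y by `recolours-sym`.
    P-recolours : ∀ {x y} → x ≢ y → P x y ≡ ∑[ v < n ] (weight v c₀ * indicator (recolours? x y v))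
    P-recolours {x} {y} x≢y = sum-cong-≗ λ v → begin
      ∑[ c < q ] (weight v c * indicator (step? v c))
        ≡⟨ sum-cong-≗ (λ c → cong₂ _*_ (cong (uniform v *_) (uniform-const c c₀)) (concentrate v c)) ⟩
      ∑[ c < q ] (weight v c₀ * (indicator (c ≟ lookup (colouring y) v) * indicator (recolours? x y v)))
        ≡⟨ *-distribˡ-∑ (weight v c₀) (λ c → indicator (c ≟ lookup (colouring y) v) * indicator (recolours? x y v)) ⟨
      weight v c₀ * ∑[ c < q ] (indicator (c ≟ lookup (colouring y) v) * indicator (recolours? x y v))
        ≡⟨ cong (weight v c₀ *_) (∑-indicatorʳ (lookup (colouring y) v) (λ _ → indicator (recolours? x y v))) ⟩
      weight v c₀ * indicator (recolours? x y v) ∎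
      where
      open ≡-Reasoning
      step? : ∀ v c → Dec (glauberStep G (colouring x) v c ≡ colouring y)
      step? v c = ≡-dec _≟_ (glauberStep G (colouring x) v c) (colouring y)
      concentrate : ∀ v c → indicator (step? v c) ≡ indicator (c ≟ lookup (colouring y) v) * indicator (recolours? x y v)
      concentrate v c with c ≟ lookup (colouring y) v
      ... | yes refl = sym (*-identityˡ (indicator (recolours? x y v)))
      ... | no c≢    = trans
        (indicator-no (step? v c)
          (λ eq → c≢ (proj₁ (step-reverse (colouring x) (proper x) (λ eq′ → x≢y (colouring-injective eq′)) v c eq))))
        (sym (*-zeroˡ (indicator (recolours? x y v))))

    P-sym : ∀ x y → P x y ≡ P y x
    P-sym x y with x ≟ y
    ... | yes refl = refl
    ... | no x≢y   = begin
      P x y                                                      ≡⟨ P-recolours x≢y ⟩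
      ∑[ v < n ] (weight v c₀ * indicator (recolours? x y v))    ≡⟨ sum-cong-≗ (λ v → cong (weight v c₀ *_)
        (indicator-cong (recolours? x y v) (recolours? y x v) (recolours-sym v x≢y) (recolours-sym v (≢-sym x≢y)))) ⟩
      ∑[ v < n ] (weight v c₀ * indicator (recolours? y x v))    ≡⟨ P-recolours (≢-sym x≢y) ⟨
      P y x                                                      ∎
      where open ≡-Reasoning

    stationary : State → IsStationary P uniform
    stationary x₀ = (0≤uniform , ∑-uniform x₀) , λ y → begin
      ∑[ x < _ ] (uniform x * P x y)   ≡⟨ sum-cong-≗ (λ x → cong₂ _*_ (uniform-const x y) (P-sym x y)) ⟩
      ∑[ x < _ ] (uniform y * P y x)   ≡⟨ *-distribˡ-∑ (uniform y) (P y) ⟨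
      uniform y * ∑[ x < _ ] P y x     ≡⟨ cong (uniform y *_) (proj₂ (stochastic y)) ⟩
      uniform y * 1ℚ                   ≡⟨ *-identityʳ (uniform y) ⟩
      uniform y                        ∎
      where open ≡-Reasoning

    Connected : Set
    Connected = ∀ {α β} → Proper G α → ¬ Frozen G α → Proper G β → ¬ Frozen G β → Star Move α β

    ergodic : Connected → IsErgodic P
    ergodic connected = record
      { stochastic  = stochastic
      ; irreducible = λ x y → 0<power-star (connected (proper x) (nonFrozen x) (proper y) (nonFrozen y)) x y refl refl
      ; aperiodic   = aperiodic loop
      }

-- The necklace graph: cyclic order of the blobs, regularity, access by blob and position

module Necklaces where

  open import Data.Nat.Base using (_+_; _*_)
  import Data.Nat.Properties as ℕ
  import Data.Parity.Properties as Parity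
  open import Data.Fin.Base using (fromℕ)
  open import Data.Fin.Relation.Unary.Top using (view; ‵fromℕ; ‵inject₁; view-fromℕ; view-inject₁)
  open import Data.Fin.Subset using () renaming (∣_∣ to card)
  open import Data.Vec.Base using (lookup; _[_]≔_; tabulate)
  open import Data.Vec.Functional using (Vector)
  open import Algebra.Properties.CommutativeMonoid.Sum ℕ.+-0-commutativeMonoid
  import Algebra.Properties.Semiring.Sum as SemiringSum
  open import Level using (0ℓ)
  open import Relation.Binary.Core using (Rel)

  next : ∀ {n} → Fin n → Fin n
  next i with view i
  ... | ‵fromℕ     = zero
  ... | ‵inject₁ j = suc j

  prev : ∀ {n} → Fin n → Fin n
  prev zero    = fromℕ _
  prev (suc i) = inject₁ i

  next-fromℕ : ∀ n → next (fromℕ n) ≡ zero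
  next-fromℕ n rewrite view-fromℕ n = refl

  next-inject₁ : ∀ {n} (i : Fin n) → next (inject₁ i) ≡ suc i
  next-inject₁ i rewrite view-inject₁ i = refl

  next-prev : ∀ {n} (i : Fin n) → next (prev i) ≡ i
  next-prev {suc n} zero    = next-fromℕ n
  next-prev         (suc i) = next-inject₁ i

  prev-next : ∀ {n} (i : Fin n) → prev (next i) ≡ i
  prev-next i with view i
  ... | ‵fromℕ     = refl
  ... | ‵inject₁ j = refl

  toℕ-next : ∀ {n} (i : Fin n) → suc (toℕ i) ℕ.< n → toℕ (next i) ≡ suc (toℕ i)
  toℕ-next i 1+i<n with view i
  ... | ‵fromℕ {n}  = contradiction (subst (λ e → suc e ℕ.< suc n) (toℕ-fromℕ n) 1+i<n) (ℕ.n≮n _)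
  ... | ‵inject₁ j = cong suc (sym (toℕ-inject₁ j))

  toℕ-prev : ∀ {n} (i : Fin n) → 0 ℕ.< toℕ i → suc (toℕ (prev i)) ≡ toℕ i
  toℕ-prev (suc i) _ = cong suc (toℕ-inject₁ i)

  next≢ : ∀ {n} (i : Fin (suc (suc n))) → next i ≢ i
  next≢ i eq with view i
  next≢ .(fromℕ _)  () | ‵fromℕ
  next≢ .(inject₁ j) eq | ‵inject₁ j = ℕ.1+n≢n (trans (cong toℕ eq) (toℕ-inject₁ j))

  prev≢ : ∀ {n} (i : Fin (suc (suc n))) → prev i ≢ i
  prev≢ i eq = next≢ (prev i) (trans (next-prev i) (sym eq))

  parity-suc : ∀ n → ℕ.parity (suc n) ≡ ℕ.parity n ⁻¹
  parity-suc n = trans (sym (Parity.⁻¹-involutive _)) (cong _⁻¹ (Parity.suc-homo-⁻¹ n))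

  -- Here n is the index of the last vertex: the hypothesis says that the cycle has even length.
  parity-next : ∀ {n} → ℕ.parity n ≡ 1ℙ → (i : Fin (suc n)) → ℕ.parity (toℕ (next i)) ≡ ℕ.parity (toℕ i) ⁻¹
  parity-next {n} odd i with view i
  ... | ‵fromℕ     = sym (trans (cong (λ e → ℕ.parity e ⁻¹) (toℕ-fromℕ n)) (cong _⁻¹ odd))
  ... | ‵inject₁ j = trans (parity-suc (toℕ j)) (cong (λ e → ℕ.parity e ⁻¹) (sym (toℕ-inject₁ j)))

  bit : ∀ {A : Set} → Dec A → ℕ
  bit A? = if does A? then 1 else 0

  bit-⊎ : ∀ {A B : Set} (A? : Dec A) (B? : Dec B) → ¬ (A × B) → bit (A? ⊎-dec B?) ≡ bit A? + bit B?
  bit-⊎ (yes a) (yes b) ¬ab = contradiction (a , b) ¬ab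
  bit-⊎ (yes _) (no _)  _   = refl
  bit-⊎ (no _)  (yes _) _   = refl
  bit-⊎ (no _)  (no _)  _   = refl

  bit-× : ∀ {A B : Set} (A? : Dec A) (B? : Dec B) → bit (A? ×-dec B?) ≡ bit A? * bit B?
  bit-× (yes _) (yes _) = refl
  bit-× (yes _) (no _)  = refl
  bit-× (no _)  (yes _) = refl
  bit-× (no _)  (no _)  = refl

  bit-¬ : ∀ {A : Set} (A? : Dec A) → bit A? + bit (¬? A?) ≡ 1
  bit-¬ (yes _) = refl
  bit-¬ (no _)  = refl

  bit-cong : ∀ {A B : Set} (A? : Dec A) (B? : Dec B) → (A → B) → (B → A) → bit A? ≡ bit B?
  bit-cong (yes a) (yes b) f g = refl
  bit-cong (yes a) (no ¬b) f g = contradiction (f a) ¬b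
  bit-cong (no ¬a) (yes b) f g = contradiction (g b) ¬a
  bit-cong (no ¬a) (no ¬b) f g = refl

  card-tabulate : ∀ {n} {A : Fin n → Set} (A? : ∀ i → Dec (A i)) → card (tabulate (does ∘ A?)) ≡ ∑[ i < n ] bit (A? i)
  card-tabulate {zero}  A? = refl
  card-tabulate {suc n} A? with A? zero
  ... | yes _ = cong suc (card-tabulate (A? ∘ suc))
  ... | no _  = card-tabulate (A? ∘ suc)

  ∑-↑ : ∀ m {n} (f : Vector ℕ (m + n)) → ∑[ i < m + n ] f i ≡ ∑[ i < m ] f (i ↑ˡ n) + ∑[ j < n ] f (m ↑ʳ j)
  ∑-↑ zero    f = refl
  ∑-↑ (suc m) f = trans (cong (f zero +_) (∑-↑ m (f ∘ suc))) (sym (ℕ.+-assoc (f zero) _ _))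

  ∑-combine : ∀ m n (f : Vector ℕ (m * n)) → ∑[ x < m * n ] f x ≡ ∑[ i < m ] ∑[ j < n ] f (combine i j)
  ∑-combine zero    n f = refl
  ∑-combine (suc m) n f = trans (∑-↑ n f) (cong (sum (λ j → f (j ↑ˡ (m * n))) +_) (∑-combine m n (f ∘ (n ↑ʳ_))))

  ∑-product : ∀ {m n} (f : Vector ℕ m) (g : Vector ℕ n) → ∑[ i < m ] ∑[ j < n ] (f i * g j) ≡ (∑[ i < m ] f i) * (∑[ j < n ] g j)
  ∑-product {m} f g = sym (trans (*-distribʳ-sum (sum g) f) (sum-cong-≗ {m} (λ i → *-distribˡ-sum (f i) g)))
    where open SemiringSum ℕ.+-*-semiring using (*-distribˡ-sum; *-distribʳ-sum)

  ∑-bit≡ : ∀ {n} (i : Fin n) → ∑[ j < n ] bit (i ≟ j) ≡ 1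
  ∑-bit≡ {suc n} zero    = cong suc (sum-replicate-zero n)
  ∑-bit≡ {suc n} (suc i) = ∑-bit≡ i

  ∑-bit≢ : ∀ {n} (i : Fin (suc n)) → ∑[ j < suc n ] bit (¬? (i ≟ j)) ≡ n
  ∑-bit≢ {n} i = ℕ.suc-injective (begin
    1 + ∑[ j < suc n ] bit (¬? (i ≟ j))                            ≡⟨ cong (_+ sum (λ j → bit (¬? (i ≟ j)))) (∑-bit≡ i) ⟨
    ∑[ j < suc n ] bit (i ≟ j) + ∑[ j < suc n ] bit (¬? (i ≟ j))   ≡⟨ ∑-distrib-+ (λ j → bit (i ≟ j)) (λ j → bit (¬? (i ≟ j))) ⟨
    ∑[ j < suc n ] (bit (i ≟ j) + bit (¬? (i ≟ j)))                ≡⟨ sum-cong-≗ {suc n} (λ j → bit-¬ (i ≟ j)) ⟩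
    ∑[ j < suc n ] 1                                               ≡⟨ ∑-one (suc n) ⟩
    suc n                                                          ∎)
    where
    open ≡-Reasoning
    ∑-one : ∀ n → ∑[ j < n ] 1 ≡ n
    ∑-one zero    = refl
    ∑-one (suc n) = cong suc (∑-one n)

  -- K_{Δ+1} minus the edge between 0 and 1 is the complete multipartite graph
  -- whose parts are the fibres of this map.
  part : ∀ {d} → Fin (suc (suc d)) → Fin (suc d)
  part zero    = zero
  part (suc j) = j

  -- Positions 0 and 1 each have d + 1 neighbours in their blob, and the last two bits supply their
  -- single link; any other position has all its d + 2 neighbours inside.
  ∑-part : ∀ {d} (j : Fin (suc (suc (suc d)))) →
           ∑[ j′ < suc (suc (suc d)) ] bit (¬? (part j ≟ part j′)) + (bit (j ≟ 1F) + bit (j ≟ 0F)) ≡ suc (suc d)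
  ∑-part {d} 0F            = trans (cong (_+ 1) (∑-bit≢ {suc d} 0F)) (ℕ.+-comm (suc d) 1)
  ∑-part {d} 1F            = trans (cong (_+ 1) (∑-bit≢ {suc d} 0F)) (ℕ.+-comm (suc d) 1)
  ∑-part {d} (suc (suc j)) = cong suc (trans (ℕ.+-identityʳ _) (∑-bit≢ (suc j)))

  -- There are N-2 + 2 blobs, and Δ = d + 2; positions 0 and 1 of a blob are its u and its v.
  module Necklace (N-2 d : ℕ) where

    N q Δ : ℕ
    N = suc (suc N-2)
    q = suc (suc (suc d))
    Δ = suc (suc d)

    Link : Rel (Fin N × Fin q) 0ℓ
    Link (i , j) (i′ , j′) = j ≡ 1F × j′ ≡ 0F × next i ≡ i′

    Adjacent : Rel (Fin N × Fin q) 0ℓ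
    Adjacent (i , j) (i′ , j′) = (i ≡ i′ × part j ≢ part j′) ⊎ (Link (i , j) (i′ , j′) ⊎ Link (i′ , j′) (i , j))

    link? : ∀ x y → Dec (Link x y)
    link? (i , j) (i′ , j′) = (j ≟ 1F) ×-dec ((j′ ≟ 0F) ×-dec (next i ≟ i′))

    adjacent? : ∀ x y → Dec (Adjacent x y)
    adjacent? (i , j) (i′ , j′) = ((i ≟ i′) ×-dec ¬? (part j ≟ part j′))
      ⊎-dec (link? (i , j) (i′ , j′) ⊎-dec link? (i′ , j′) (i , j))

    adjacent-sym : ∀ {x y} → Adjacent x y → Adjacent y x
    adjacent-sym (inj₁ (i≡i′ , j≢j′)) = inj₁ (sym i≡i′ , ≢-sym j≢j′)
    adjacent-sym (inj₂ (inj₁ link))   = inj₂ (inj₂ link)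
    adjacent-sym (inj₂ (inj₂ link))   = inj₂ (inj₁ link)

    ¬adjacent-refl : ∀ {x} → ¬ Adjacent x x
    ¬adjacent-refl (inj₁ (_ , j≢j))               = j≢j refl
    ¬adjacent-refl (inj₂ (inj₁ (refl , () , _)))
    ¬adjacent-refl (inj₂ (inj₂ (refl , () , _)))

    -- Opaque, so that unification can read off blobs and positions instead of unfolding
    -- the arithmetic of vertex numbers.
    opaque
      G : Graph (N * q)
      G .Graph.Adj x y             = Adjacent (remQuot {N} q x) (remQuot {N} q y)
      G .Graph.adj? x y            = adjacent? (remQuot {N} q x) (remQuot {N} q y)
      G .Graph.sym {x} {y}         = adjacent-sym {remQuot {N} q x} {remQuot {N} q y}
      G .Graph.irrefl {x} refl     = ¬adjacent-refl {remQuot {N} q x}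

    -- Adjacency splits into three disjoint cases: same blob, link out of x, link into x. Each
    -- indicator factors into a condition on the blob and one on the position, so each double sum is
    -- a product of simple counts.
    degree-Adjacent : ∀ x → ∑[ i < N ] ∑[ j < q ] bit (adjacent? x (i , j)) ≡ Δ
    degree-Adjacent (i , j) = begin
      ∑[ i′ < N ] ∑[ j′ < q ] bit (adjacent? (i , j) (i′ , j′))
        ≡⟨ sum-cong-≗ {N} (λ i′ → sum-cong-≗ {q} (λ j′ → split i′ j′)) ⟩
      ∑[ i′ < N ] ∑[ j′ < q ] (inner i′ j′ + (out i′ j′ + into i′ j′))
        ≡⟨ trans (∑∑-distrib-+ inner (λ i′ j′ → out i′ j′ + into i′ j′)) (cong (∑∑ inner +_) (∑∑-distrib-+ out into)) ⟩
      ∑∑ inner + (∑∑ out + ∑∑ into)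
        ≡⟨ cong₂ _+_
             (trans (∑-product {N} {q} (λ i′ → bit (i ≟ i′)) (λ j′ → bit (¬? (part j ≟ part j′))))
               (trans (cong (_* sum (λ j′ → bit (¬? (part j ≟ part j′)))) (∑-bit≡ i)) (ℕ.*-identityˡ _)))
             (cong₂ _+_
               (trans (∑-product {N} {q} (λ i′ → bit (next i ≟ i′)) (λ j′ → bit (j ≟ 1F) * bit (0F ≟ j′)))
                 (count (next i) (bit (j ≟ 1F)) 0F))
               (trans (∑-product {N} {q} (λ i′ → bit (prev i ≟ i′)) (λ j′ → bit (j ≟ 0F) * bit (1F ≟ j′)))
                 (count (prev i) (bit (j ≟ 0F)) 1F))) ⟩
      ∑[ j′ < q ] bit (¬? (part j ≟ part j′)) + (bit (j ≟ 1F) + bit (j ≟ 0F))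
        ≡⟨ ∑-part j ⟩
      Δ ∎
      where
      open ≡-Reasoning
      ∑∑ : (Fin N → Fin q → ℕ) → ℕ
      ∑∑ f = ∑[ i < N ] ∑[ j < q ] f i j
      ∑∑-distrib-+ : ∀ f g → ∑∑ (λ i j → f i j + g i j) ≡ ∑∑ f + ∑∑ g
      ∑∑-distrib-+ f g = trans (sum-cong-≗ {N} (λ i → ∑-distrib-+ (f i) (g i))) (∑-distrib-+ (λ i → sum (f i)) (λ i → sum (g i)))
      inner out into : Fin N → Fin q → ℕ
      inner i′ j′ = bit (i ≟ i′) * bit (¬? (part j ≟ part j′))
      out   i′ j′ = bit (next i ≟ i′) * (bit (j ≟ 1F) * bit (0F ≟ j′))
      into  i′ j′ = bit (prev i ≟ i′) * (bit (j ≟ 0F) * bit (1F ≟ j′))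
      count : ∀ (i′ : Fin N) b (j′ : Fin q) → (∑[ x < N ] bit (i′ ≟ x)) * (∑[ y < q ] (b * bit (j′ ≟ y))) ≡ b
      count i′ b j′ = trans (cong₂ _*_ (∑-bit≡ i′) (trans (sym (*-distribˡ-sum b (λ y → bit (j′ ≟ y)))) (cong (b *_) (∑-bit≡ j′))))
                            (trans (ℕ.*-identityˡ _) (ℕ.*-identityʳ b))
        where open SemiringSum ℕ.+-*-semiring using (*-distribˡ-sum)
      split : ∀ i′ j′ → bit (adjacent? (i , j) (i′ , j′)) ≡ inner i′ j′ + (out i′ j′ + into i′ j′)
      split i′ j′ = trans
        -- The cases are disjoint because a link joins distinct blobs, `next` having no fixed point,
        -- and because its source is at position 1 and its target at position 0.
        (bit-⊎ ((i ≟ i′) ×-dec ¬? (part j ≟ part j′)) (link? (i , j) (i′ , j′) ⊎-dec link? (i′ , j′) (i , j)) λ where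
          ((i≡i′ , _) , inj₁ (_ , _ , eq)) → next≢ i (trans eq (sym i≡i′))
          ((i≡i′ , _) , inj₂ (_ , _ , eq)) → next≢ i′ (trans eq i≡i′))
        (cong₂ _+_ (bit-× (i ≟ i′) (¬? (part j ≟ part j′)))
          (trans (bit-⊎ (link? (i , j) (i′ , j′)) (link? (i′ , j′) (i , j)) (λ { ((refl , _) , (_ , () , _)) }))
            (cong₂ _+_ bit-out bit-into)))
        where
        bit-out : bit (link? (i , j) (i′ , j′)) ≡ out i′ j′
        bit-out = trans (bit-cong (link? (i , j) (i′ , j′)) ((next i ≟ i′) ×-dec ((j ≟ 1F) ×-dec (0F ≟ j′)))
            (λ (a , b , c) → c , a , sym b) (λ (c , a , b) → a , sym b , c))
          (trans (bit-× (next i ≟ i′) ((j ≟ 1F) ×-dec (0F ≟ j′))) (cong (bit (next i ≟ i′) *_) (bit-× (j ≟ 1F) (0F ≟ j′))))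
        bit-into : bit (link? (i′ , j′) (i , j)) ≡ into i′ j′
        bit-into = trans (bit-cong (link? (i′ , j′) (i , j)) ((prev i ≟ i′) ×-dec ((j ≟ 0F) ×-dec (1F ≟ j′)))
            (λ (a , b , c) → trans (cong prev (sym c)) (prev-next i′) , b , sym a)
            (λ (c , b , a) → sym a , b , trans (cong next (sym c)) (next-prev i)))
          (trans (bit-× (prev i ≟ i′) ((j ≟ 0F) ×-dec (1F ≟ j′))) (cong (bit (prev i ≟ i′) *_) (bit-× (j ≟ 0F) (1F ≟ j′))))

    opaque
      unfolding G

      regular : Graph.IsRegular G Δ
      regular v = begin
        card (Graph.neighbours G v)
          ≡⟨ card-tabulate (λ u → adjacent? (remQuot {N} q v) (remQuot {N} q u)) ⟩
        ∑[ u < N * q ] bit (adjacent? (remQuot {N} q v) (remQuot {N} q u))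
          ≡⟨ ∑-combine N q (λ u → bit (adjacent? (remQuot {N} q v) (remQuot {N} q u))) ⟩
        ∑[ i < N ] ∑[ j < q ] bit (adjacent? (remQuot {N} q v) (remQuot {N} q (combine i j)))
          ≡⟨ sum-cong-≗ {N} (λ i → sum-cong-≗ {q} (λ j → cong (bit ∘ adjacent? (remQuot {N} q v)) (remQuot-combine {N} {q} i j))) ⟩
        ∑[ i < N ] ∑[ j < q ] bit (adjacent? (remQuot {N} q v) (i , j))
          ≡⟨ degree-Adjacent (remQuot {N} q v) ⟩
        Δ ∎
        where open ≡-Reasoning

    opaque
      unfolding G

      vertex : Fin N → Fin q → Fin (N * q)
      vertex = combine

      _⟨_,_⟩ : Colouring q (N * q) → Fin N → Fin q → Fin q
      α ⟨ i , j ⟩ = lookup α (combine i j)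

      lookup-vertex : ∀ α i j → lookup α (vertex i j) ≡ α ⟨ i , j ⟩
      lookup-vertex α i j = refl

      vertex-surjective : ∀ v → ∃[ i ] ∃[ j ] vertex i j ≡ v
      vertex-surjective = combine-surjective {N} {q}

      vertex-injective : ∀ i j i′ j′ → vertex i j ≡ vertex i′ j′ → i ≡ i′ × j ≡ j′
      vertex-injective = combine-injective {N} {q}

      fill : (Fin N → Fin q → Fin q) → Colouring q (N * q)
      fill g = tabulate (uncurry g ∘ remQuot {N} q)

      fill-⟨⟩ : ∀ g i j → fill g ⟨ i , j ⟩ ≡ g i j
      fill-⟨⟩ g i j = trans (lookup∘tabulate (uncurry g ∘ remQuot {N} q) (combine i j))
        (cong (uncurry g) (remQuot-combine {N} {q} i j))

      Adj-vertex : ∀ i j i′ j′ → Adjacent (i , j) (i′ , j′) → Graph.Adj G (vertex i j) (vertex i′ j′)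
      Adj-vertex i j i′ j′ = subst₂ Adjacent (sym (remQuot-combine {N} {q} i j)) (sym (remQuot-combine {N} {q} i′ j′))

      Adj-vertex⁻ : ∀ i j i′ j′ → Graph.Adj G (vertex i j) (vertex i′ j′) → Adjacent (i , j) (i′ , j′)
      Adj-vertex⁻ i j i′ j′ = subst₂ Adjacent (remQuot-combine {N} {q} i j) (remQuot-combine {N} {q} i′ j′)

    module _ {α : Colouring q (N * q)} (proper : Proper G α) where

      proper-inner : ∀ {i j j′} → part j ≢ part j′ → α ⟨ i , j ⟩ ≢ α ⟨ i , j′ ⟩
      proper-inner {i} {j} {j′} j≢j′ = subst₂ _≢_ (lookup-vertex α i j) (lookup-vertex α i j′)
        (proper (vertex i j) (vertex i j′) (Adj-vertex i j i j′ (inj₁ (refl , j≢j′))))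

    toProper : ∀ {α} → (∀ i j j′ → part j ≢ part j′ → α ⟨ i , j ⟩ ≢ α ⟨ i , j′ ⟩) →
               (∀ i → α ⟨ i , 1F ⟩ ≢ α ⟨ next i , 0F ⟩) → Proper G α
    toProper {α} inner link x y x~y with vertex-surjective x | vertex-surjective y
    ... | i , j , refl | i′ , j′ , refl = subst₂ _≢_ (sym (lookup-vertex α i j)) (sym (lookup-vertex α i′ j′))
      (pairs i j i′ j′ (Adj-vertex⁻ i j i′ j′ x~y))
      where
      pairs : ∀ i j i′ j′ → Adjacent (i , j) (i′ , j′) → α ⟨ i , j ⟩ ≢ α ⟨ i′ , j′ ⟩
      pairs i j _ j′ (inj₁ (refl , j≢j′))                 = inner i j j′ j≢j′
      pairs i _ _ _  (inj₂ (inj₁ (refl , refl , refl)))   = link i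
      pairs _ _ i _  (inj₂ (inj₂ (refl , refl , refl)))   = ≢-sym (link i)

    -- The two link hypotheses are guarded by the position, so that the inner vertices of a blob
    -- discharge them by absurdity.
    absent : ∀ {α i j c} → (∀ j′ → part j ≢ part j′ → α ⟨ i , j′ ⟩ ≢ c) →
             (j ≡ 1F → α ⟨ next i , 0F ⟩ ≢ c) → (j ≡ 0F → α ⟨ prev i , 1F ⟩ ≢ c) → ¬ Appears G α (vertex i j) c
    absent {α} {i} {j} {c} inner out into (u , v~u , αu≡c) with vertex-surjective u
    ... | i′ , j′ , refl = cases i′ j′ (Adj-vertex⁻ i j i′ j′ v~u) (trans (sym (lookup-vertex α i′ j′)) αu≡c)
      where
      cases : ∀ i′ j′ → Adjacent (i , j) (i′ , j′) → α ⟨ i′ , j′ ⟩ ≢ c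
      cases _ j′ (inj₁ (refl , j≢j′))               = inner j′ j≢j′
      cases _ _  (inj₂ (inj₁ (j≡1 , refl , refl)))  = out j≡1
      cases i′ _ (inj₂ (inj₂ (refl , j≡0 , refl)))  = λ eq → into j≡0 (trans (cong (λ i → α ⟨ i , 1F ⟩) (prev-next i′)) eq)

    module _ {α : Colouring q (N * q)} {i j c} (∄u : ¬ Appears G α (vertex i j) c) where

      absent-inner : ∀ j′ → part j ≢ part j′ → α ⟨ i , j′ ⟩ ≢ c
      absent-inner j′ j≢j′ eq = ∄u (vertex i j′ , Adj-vertex i j i j′ (inj₁ (refl , j≢j′)) , trans (lookup-vertex α i j′) eq)

      absent-next : j ≡ 1F → α ⟨ next i , 0F ⟩ ≢ c
      absent-next j≡1 eq = ∄u (vertex (next i) 0F , Adj-vertex i j (next i) 0F (inj₂ (inj₁ (j≡1 , refl , refl))) ,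
        trans (lookup-vertex α (next i) 0F) eq)

      absent-prev : j ≡ 0F → α ⟨ prev i , 1F ⟩ ≢ c
      absent-prev j≡0 eq = ∄u (vertex (prev i) 1F , Adj-vertex i j (prev i) 1F (inj₂ (inj₂ (refl , j≡0 , next-prev i))) ,
        trans (lookup-vertex α (prev i) 1F) eq)

    set-same : ∀ (α : Colouring q (N * q)) i j c → (α [ vertex i j ]≔ c) ⟨ i , j ⟩ ≡ c
    set-same α i j c = trans (sym (lookup-vertex _ i j)) (lookup∘update (vertex i j) α c)

    set-position : ∀ (α : Colouring q (N * q)) i {j j′} c i′ → j′ ≢ j → (α [ vertex i j ]≔ c) ⟨ i′ , j′ ⟩ ≡ α ⟨ i′ , j′ ⟩
    set-position α i {j} {j′} c i′ j′≢j = trans (sym (lookup-vertex _ i′ j′))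
      (trans (lookup∘update′ (j′≢j ∘ proj₂ ∘ vertex-injective i′ j′ i j) α c) (lookup-vertex α i′ j′))

    set-blob : ∀ (α : Colouring q (N * q)) {i i′} j c j′ → i′ ≢ i → (α [ vertex i j ]≔ c) ⟨ i′ , j′ ⟩ ≡ α ⟨ i′ , j′ ⟩
    set-blob α {i} {i′} j c j′ i′≢i = trans (sym (lookup-vertex _ i′ j′))
      (trans (lookup∘update′ (i′≢i ∘ proj₁ ∘ vertex-injective i′ j′ i j) α c) (lookup-vertex α i′ j′))

-- Connectedness of the non-frozen colourings

module Connectedness where

  open import Data.Nat.Base using (z≤n; s≤s; _+_; _*_)
  import Data.Nat.Properties as ℕ
  import Data.Parity.Properties as Parity
  open import Data.Fin.Induction using (<-weakInduction; >-weakInduction)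
  open import Data.Vec.Base using (Vec; lookup; _[_]≔_)
  open import Function.Definitions using (Injective)
  open import Relation.Binary.Construct.Closure.ReflexiveTransitive using (Star; ε; _◅_; _◅◅_)
  open GlauberDynamics
  open Necklaces

  -- Pigeonhole: if every value were hit, choosing preimages would inject `Fin n` into the smaller
  -- `Fin m`.
  avoid : ∀ {m n} → m ℕ.< n → (f : Fin m → Fin n) → ∃[ c ] (∀ j → f j ≢ c)
  avoid {m} {n} m<n f with all? (λ c → any? (λ j → f j ≟ c))
  ... | yes hit = contradiction
    (λ {c} {c′} eq → trans (sym (proj₂ (hit c))) (trans (cong f eq) (proj₂ (hit c′))))
    (<⇒notInjective {f = proj₁ ∘ hit} m<n)
  ... | no ¬hit with ¬∀⟶∃¬ n _ (λ c → any? (λ j → f j ≟ c)) ¬hit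
  ...   | c , miss = c , λ j eq → miss (j , eq)

  -- The place where at least four colours are used.
  avoid₃ : ∀ {n} (a b c : Fin (4 + n)) → ∃[ x ] (a ≢ x × b ≢ x × c ≢ x)
  avoid₃ a b c with avoid {3} (s≤s (s≤s (s≤s (s≤s z≤n)))) (λ { 0F → a ; 1F → b ; 2F → c })
  ... | x , miss = x , miss 0F , miss 1F , miss 2F

  -- A missed value could be punched out of the codomain, leaving an injection into a smaller set.
  injective⇒surjective : ∀ {n} {f : Fin n → Fin n} → Injective _≡_ _≡_ f → ∀ c → ∃[ j ] f j ≡ c
  injective⇒surjective {suc n} {f} inj c with any? (λ j → f j ≟ c)
  ... | yes hit = hit
  ... | no miss = contradiction
    (λ {j} {j′} eq → inj (punchOut-injective (c≢ j) (c≢ j′) eq))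
    (<⇒notInjective {f = λ j → punchOut (c≢ j)} (ℕ.n<1+n n))
    where
    c≢ : ∀ j → c ≢ f j
    c≢ j eq = miss (j , sym eq)

  part-fibre : ∀ {d} (j j′ : Fin (suc (suc d))) → part j ≡ part j′ → j ≡ j′ ⊎ (j ≡ 0F × j′ ≡ 1F) ⊎ (j ≡ 1F × j′ ≡ 0F)
  part-fibre 0F       0F        eq   = inj₁ refl
  part-fibre 0F       (suc j′)  refl = inj₂ (inj₁ (refl , refl))
  part-fibre (suc j)  0F        refl = inj₂ (inj₂ (refl , refl))
  part-fibre (suc j)  (suc j′)  eq   = inj₁ (cong suc eq)

  vec-ext : ∀ {A : Set} {n} {xs ys : Vec A n} → (∀ i → lookup xs i ≡ lookup ys i) → xs ≡ ys
  vec-ext {xs = xs} {ys} eq = trans (sym (tabulate∘lookup xs)) (trans (tabulate-cong eq) (tabulate∘lookup ys))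

  Next : ∀ {n} → Fin n → Fin n → Set
  Next i j = next i ≡ j

  -- Only forward steps are available, because `same-next` acts on the following blob. The walk goes
  -- on to the wrap at zero and from there up to j.
  round-trip : ∀ {n} (i j : Fin (suc n)) → Star Next i j
  round-trip {n} i j = to-zero i ◅◅ from-zero j
    where
    to-zero : ∀ i → Star Next i zero
    to-zero = >-weakInduction (λ i → Star Next i zero) (next-fromℕ n ◅ ε) (λ i ns → next-inject₁ i ◅ ns)
    from-zero : ∀ i → Star Next zero i
    from-zero = <-weakInduction (λ i → Star Next zero i) ε (λ i ns → ns ◅◅ (next-inject₁ i ◅ ε))

  module Connectivity (N-2 r : ℕ) (odd : ℕ.parity (suc N-2) ≡ 1ℙ) where
    open Necklace N-2 (suc r)
    open Moves G {q}

    Col : Set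
    Col = Colouring q (N * q)

    star-sym : ∀ {α β} → Proper G α → Star Move α β → Star Move β α
    star-sym     p ε        = ε
    star-sym {α} p (m ◅ ms) = star-sym (move-proper {α} m p) ms ◅◅ (move-sym {α} p m ◅ ε)

    Reaches : Col → (Col → Set) → Set
    Reaches α Q = ∃[ β ] (Star Move α β × Q β)

    and-then : ∀ {α} {Q R : Col → Set} → Proper G α → Reaches α Q →
               (∀ {β} → Proper G β → Q β → Reaches β R) → Reaches α R
    and-then p (β , moves , qβ) f with f {β} (star-proper moves p) qβ
    ... | γ , moves′ , rγ = γ , moves ◅◅ moves′ , rγ

    Same : Col → Fin N → Set
    Same α i = α ⟨ i , 0F ⟩ ≡ α ⟨ i , 1F ⟩

    -- Position 0 repeats the colour of position 1, so at most q - 1 colours occur in the blob.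
    blob-missing : ∀ {α i} → Same α i → ∃[ m ] (∀ j → α ⟨ i , j ⟩ ≢ m)
    blob-missing {α} {i} same with avoid (ℕ.n<1+n _) (λ j → α ⟨ i , suc j ⟩)
    ... | m , miss = m , λ where
      0F      eq → miss 0F (trans (sym same) eq)
      (suc j) eq → miss j eq

    -- The only non-adjacent pair of the blob is u, v. If these differ too, the q vertices have q
    -- distinct colours.
    blob-full : ∀ {α i} → Proper G α → ¬ Same α i → ∀ c → ∃[ j ] α ⟨ i , j ⟩ ≡ c
    blob-full {α} {i} p ¬same = injective⇒surjective λ {j} {j′} → inj j j′
      where
      inj : ∀ j j′ → α ⟨ i , j ⟩ ≡ α ⟨ i , j′ ⟩ → j ≡ j′
      inj j j′ eq with part j ≟ part j′
      ... | no j≢j′ = contradiction eq (proper-inner {α} p {i} {j} {j′} j≢j′)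
      ... | yes j~j′ with part-fibre j j′ j~j′
      ...   | inj₁ j≡j′                = j≡j′
      ...   | inj₂ (inj₁ (refl , refl)) = contradiction eq ¬same
      ...   | inj₂ (inj₂ (refl , refl)) = contradiction (sym eq) ¬same

    -- The last two fields confine the changes to vertices of blob i wearing c, so that whatever is
    -- already arranged survives.
    record FreeColour (α : Col) (i : Fin N) (c : Fin q) : Set where
      field
        {β}       : Col
        moves     : Star Move α β
        free      : ∀ j → β ⟨ i , j ⟩ ≢ c
        elsewhere : ∀ {i′} j → i′ ≢ i → β ⟨ i′ , j ⟩ ≡ α ⟨ i′ , j ⟩
        unaffected : ∀ j → α ⟨ i , j ⟩ ≢ c → β ⟨ i , j ⟩ ≡ α ⟨ i , j ⟩

    -- As u and v do not wear c, only an inner vertex can. All neighbours of that vertex lie in its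
    -- blob, so it may move to the colour missing there.
    free-colour : ∀ {α i c} → Proper G α → Same α i → α ⟨ i , 0F ⟩ ≢ c → FreeColour α i c
    free-colour {α} {i} {c} p same 0≢c with any? (λ j → α ⟨ i , j ⟩ ≟ c)
    ... | no miss = record
      { moves = ε ; free = λ j eq → miss (j , eq) ; elsewhere = λ _ _ → refl ; unaffected = λ _ _ → refl }
    ... | yes (0F , eq) = contradiction eq 0≢c
    ... | yes (1F , eq) = contradiction (trans same eq) 0≢c
    ... | yes (j@(suc (suc _)) , refl) with blob-missing {α} {i} same
    ...   | m , miss = record
      { moves      = (vertex i j , m , absent {α} (λ j′ _ → miss j′) (λ ()) (λ ()) , refl) ◅ ε
      ; free       = free
      ; elsewhere  = λ j′ i′≢i → set-blob α j m j′ i′≢i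
      ; unaffected = λ j′ j′≢ → set-position α i m i (λ { refl → j′≢ refl })
      }
      where
      free : ∀ j′ → (α [ vertex i j ]≔ m) ⟨ i , j′ ⟩ ≢ α ⟨ i , j ⟩
      free j′ eq with j′ ≟ j
      ... | yes refl = miss j (trans (sym eq) (set-same α i j m))
      ... | no j′≢j  = proper-inner {α} p {i} {j′} {j} (λ j~j′ → j′≢j (fibre (part-fibre j′ j j~j′)))
                         (trans (sym (set-position α i m i j′≢j)) eq)
        where
        fibre : j′ ≡ j ⊎ (j′ ≡ 0F × j ≡ 1F) ⊎ (j′ ≡ 1F × j ≡ 0F) → j′ ≡ j
        fibre (inj₁ eq) = eq
        fibre (inj₂ (inj₁ (_ , ())))
        fibre (inj₂ (inj₂ (_ , ())))

    record Repaint (α : Col) (i : Fin N) (c : Fin q) : Set where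
      field
        {β}       : Col
        moves     : Star Move α β
        colour₀   : β ⟨ i , 0F ⟩ ≡ c
        colour₁   : β ⟨ i , 1F ⟩ ≡ c
        elsewhere : ∀ {i′} j → i′ ≢ i → β ⟨ i′ , j ⟩ ≡ α ⟨ i′ , j ⟩

      same : ∀ {i′} → Same α i′ → Same β i′
      same {i′} eq with i′ ≟ i
      ... | yes refl = trans colour₀ (sym colour₁)
      ... | no i′≢i  = trans (elsewhere 0F i′≢i) (trans eq (sym (elsewhere 1F i′≢i)))

    -- Once c is cleared from the blob, the only other obstacles are the two link neighbours, which
    -- are excluded by hypothesis. So u and then v take c.
    repaint : ∀ {α i c} → Proper G α → Same α i → α ⟨ prev i , 1F ⟩ ≢ c → α ⟨ next i , 0F ⟩ ≢ c → Repaint α i c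
    repaint {α} {i} {c} p same prev≢c next≢c with α ⟨ i , 0F ⟩ ≟ c
    ... | yes eq = record { moves = ε ; colour₀ = eq ; colour₁ = trans (sym same) eq ; elsewhere = λ _ _ → refl }
    ... | no 0≢c = record
      { moves     = moves ◅◅ (
          (vertex i 0F , c , absent {β} (λ j _ → free j) (λ ()) (λ _ eq → prev≢c (trans (sym (elsewhere 1F (prev≢ i))) eq)) , refl) ◅
          (vertex i 1F , c , absent {β₁} (λ j j≢ eq → free j (trans (sym (set-position β i c i (λ { refl → j≢ refl }))) eq))
            (λ _ eq → next≢c (trans (sym (trans (set-blob β 0F c 0F (next≢ i)) (elsewhere 0F (next≢ i)))) eq)) (λ ()) , refl) ◅ ε)
      ; colour₀   = trans (set-position β₁ i c i (λ ())) (set-same β i 0F c)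
      ; colour₁   = set-same β₁ i 1F c
      ; elsewhere = λ j i′≢i → trans (set-blob β₁ 1F c j i′≢i) (trans (set-blob β 0F c j i′≢i) (elsewhere j i′≢i))
      }
      where
      open FreeColour (free-colour {α} {i} p same 0≢c)
      β₁ : Col
      β₁ = β [ vertex i 0F ]≔ c

    -- Recolouring a blob of type Same releases position 0 of the blob after it.
    same-next : ∀ {α i} → Proper G α → Same α i →
                ∃[ β ] (Star Move α β × Same β (next i) × (∀ i′ → Same α i′ → Same β i′))
    same-next {α} {i} p same with α ⟨ next i , 0F ⟩ ≟ α ⟨ next i , 1F ⟩
    ... | yes same′ = α , ε , same′ , λ _ s → s
    -- Avoiding the first two colours makes the repainting legal. Avoiding the third lets u of the
    -- next blob copy its v afterwards, since its link neighbour then wears c.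
    ... | no ¬same with avoid₃ (α ⟨ prev i , 1F ⟩) (α ⟨ next i , 0F ⟩) (α ⟨ next i , 1F ⟩)
    ...   | c , prev≢c , next₀≢c , next₁≢c = γ , moves ◅◅ (release ◅ ε) , same-γ , λ i′ s →
        trans (set-blob β 0F b 0F (i′≢ i′ s)) (trans (Repaint.same painted s) (sym (set-blob β 0F b 1F (i′≢ i′ s))))
      where
      painted = repaint {α} {i} p same prev≢c next₀≢c
      open Repaint painted hiding (same)
      b = β ⟨ next i , 1F ⟩
      γ : Col
      γ = β [ vertex (next i) 0F ]≔ b
      release : Move β γ
      release = vertex (next i) 0F , b , absent {β}
        (λ j j≢ → ≢-sym (proper-inner {β} (star-proper moves p) {next i} {1F} {j} j≢)) (λ ())
        (λ _ eq → next₁≢c (trans (sym (elsewhere 1F (next≢ i))) (trans (sym eq)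
          (trans (cong (λ i → β ⟨ i , 1F ⟩) (prev-next i)) colour₁)))) , refl
      same-γ : Same γ (next i)
      same-γ = trans (set-same β (next i) 0F b) (sym (set-position β (next i) b (next i) (λ ())))
      i′≢ : ∀ i′ → Same α i′ → i′ ≢ next i
      i′≢ i′ s refl = ¬same s

    spread : ∀ {α i j} → Star Next i j → Proper G α → Same α i →
             ∃[ β ] (Star Move α β × Same β j × (∀ i′ → Same α i′ → Same β i′))
    spread {α} ε             p same = α , ε , same , λ _ s → s
    spread {α} {i} (refl ◅ rest) p same with same-next {α} {i} p same
    ... | β , moves , same′ , keep with spread {β} {next i} rest (star-proper moves p) same′
    ...   | γ , moves′ , same″ , keep′ = γ , moves ◅◅ moves′ , same″ , λ i′ s → keep′ i′ (keep i′ s)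

    Progress : ∀ {m} → (Col → Set) → (Fin m → Col → Set) → Fin m → Col → Set
    Progress Inv Q j α = ∃[ β ] (Star Move α β × Inv β × Q j β × (∀ j′ → Q j′ α → Q j′ β))

    -- Induction on m: as progress on one index never destroys what holds at another, the property
    -- just achieved can join the invariant for the rest.
    one-by-one : ∀ {m} (Inv : Col → Set) (Q : Fin m → Col → Set) →
                 (∀ j {α} → Proper G α → Inv α → Progress Inv Q j α) →
                 ∀ {α} → Proper G α → Inv α → ∃[ β ] (Star Move α β × Inv β × (∀ j → Q j β))
    one-by-one {zero}  Inv Q progress {α} p inv = α , ε , inv , λ ()
    one-by-one {suc m} Inv Q progress {α} p inv with progress zero {α} p inv
    ... | β , moves , inv′ , q₀ , _ with one-by-one (λ α → Inv α × Q zero α) (Q ∘ suc)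
          (λ j {α} p (inv , q₀) → let γ , moves , inv′ , qⱼ , keep = progress (suc j) {α} p inv
                              in γ , moves , (inv′ , keep zero q₀) , qⱼ , keep ∘ suc)
          (star-proper moves p) (inv′ , q₀)
    ...   | γ , moves′ , (inv″ , q₀′) , qs = γ , moves ◅◅ moves′ , inv″ , λ where
            zero    → q₀′
            (suc j) → qs j

    -- In a blob seeing all colours, a colour missing around a vertex sits on the other vertex of its part.
    make-same : ∀ {α} → Proper G α → ∀ i j c → ¬ Same α i → ¬ Appears G α (vertex i j) c → α ⟨ i , j ⟩ ≢ c →
                Same (α [ vertex i j ]≔ c) i
    make-same {α} p i j c ¬same ∄u αij≢c with blob-full {α} {i} p ¬same c
    ... | j′ , eq with part j ≟ part j′
    ...   | no j≢j′  = contradiction eq (absent-inner {α} {i} {j} ∄u j′ j≢j′)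
    ...   | yes j~j′ with part-fibre j j′ j~j′
    ...     | inj₁ refl                 = contradiction eq αij≢c
    ...     | inj₂ (inj₁ (refl , refl)) = trans (set-same α i 0F c) (trans (sym eq) (sym (set-position α i c i (λ ()))))
    ...     | inj₂ (inj₂ (refl , refl)) = trans (set-position α i c i (λ ())) (trans eq (sym (set-same α i 1F c)))

    some-same : ∀ {α} → Proper G α → ¬ Frozen G α → ∃[ β ] (Star Move α β × ∃[ i ] Same β i)
    some-same {α} p ¬frozen = cases (any? (λ i → α ⟨ i , 0F ⟩ ≟ α ⟨ i , 1F ⟩)) (unfrozen {α} ¬frozen)
      where
      cases : Dec (∃[ i ] Same α i) → ∃[ v ] ∃[ c ] (¬ Appears G α v c × lookup α v ≢ c) → ∃[ β ] (Star Move α β × ∃[ i ] Same β i)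
      cases (yes same) _ = α , ε , same
      cases (no none) (v , c , ∄u , αv≢c) with vertex-surjective v
      ... | i , j , refl = (α [ vertex i j ]≔ c) , (vertex i j , c , ∄u , refl) ◅ ε , i ,
        make-same {α} p i j c (λ s → none (i , s)) ∄u (λ eq → αv≢c (trans (lookup-vertex α i j) eq))

    AllSame : Col → Set
    AllSame α = ∀ i → Same α i

    spread-to : ∀ i j {α} → Proper G α → Same α i → Progress (λ α → Same α i) (λ j α → Same α j) j α
    spread-to i j {α} p same with spread {α} {i} (round-trip i j) p same
    ... | β , moves , sameⱼ , keep = β , moves , keep i same , sameⱼ , keep

    all-same : ∀ {α} → Proper G α → ∀ i → Same α i → ∃[ β ] (Star Move α β × AllSame β)
    all-same {α} p i same with one-by-one (λ α → Same α i) (λ j α → Same α j) (spread-to i) {α} p same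
    ... | β , moves , _ , sames = β , moves , sames

    -- Recolouring the even cycle of blobs

    phase : Fin N → Parity
    phase i = ℕ.parity (toℕ i)

    phase-next : ∀ i → phase (next i) ≡ phase i ⁻¹
    phase-next = parity-next odd

    phase-prev : ∀ i → phase (prev i) ≡ phase i ⁻¹
    phase-prev i = trans (sym (Parity.⁻¹-involutive _)) (cong _⁻¹ (trans (sym (phase-next (prev i))) (cong phase (next-prev i))))

    shade : Parity → Fin q
    shade 0ℙ = 0F
    shade 1ℙ = 1F

    Shaded : Parity → Fin N → Col → Set
    Shaded b i α = phase i ≡ b → α ⟨ i , 0F ⟩ ≡ shade b

    repainted : ∀ {α i c} (R : Repaint α i c) (Q : Fin N → Fin q → Set) {i′} →
                (i′ ≡ i → Q i′ c) → Q i′ (α ⟨ i′ , 0F ⟩) → Q i′ (Repaint.β R ⟨ i′ , 0F ⟩)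
    repainted {i = i} R Q {i′} new old with i′ ≟ i
    ... | yes refl = subst (Q i′) (sym (Repaint.colour₀ R)) (new refl)
    ... | no i′≢i  = subst (Q i′) (sym (Repaint.elsewhere R 0F i′≢i)) old

    -- Vacates colour 0 from the cycle of blobs, so that the even blobs can take it afterwards. Each
    -- replacement colour also avoids 0, so no blob picks it up again.
    no-zero : ∀ {α} → Proper G α → (∀ i → Same α i) →
              ∃[ β ] (Star Move α β × (∀ i → Same β i) × (∀ i → β ⟨ i , 0F ⟩ ≢ 0F))
    no-zero = one-by-one (λ α → ∀ i → Same α i) (λ i α → α ⟨ i , 0F ⟩ ≢ 0F) λ i {α} p same →
      let c , 0≢c , prev≢c , next≢c = avoid₃ 0F (α ⟨ prev i , 1F ⟩) (α ⟨ next i , 0F ⟩)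
          R = repaint {α} {i} p (same i) prev≢c next≢c
      in Repaint.β R , Repaint.moves R , (λ i′ → Repaint.same R (same i′)) ,
         (λ eq → 0≢c (trans (sym eq) (Repaint.colour₀ R))) ,
         λ i′ → repainted R (λ _ x → x ≢ 0F) (λ _ eq → 0≢c (sym eq))

    -- Both neighbours of an even blob are odd, the cycle having even length. Odd blobs stay clear
    -- of 0, so nothing blocks 0 on an even blob.
    shade-evens : ∀ {α} → Proper G α → (∀ i → Same α i) × (∀ i → phase i ≡ 1ℙ → α ⟨ i , 0F ⟩ ≢ 0F) →
                  ∃[ β ] (Star Move α β × ((∀ i → Same β i) × (∀ i → phase i ≡ 1ℙ → β ⟨ i , 0F ⟩ ≢ 0F)) × (∀ i → Shaded 0ℙ i β))
    shade-evens = one-by-one Inv (Shaded 0ℙ) progress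
      where
      Inv : Col → Set
      Inv α = (∀ i → Same α i) × (∀ i → phase i ≡ 1ℙ → α ⟨ i , 0F ⟩ ≢ 0F)
      progress : ∀ i {α} → Proper G α → Inv α → Progress Inv (Shaded 0ℙ) i α
      progress i {α} p inv@(same , odds) with phase i in eq
      ... | 1ℙ = α , ε , inv , (λ ()) , λ _ s → s
      ... | 0ℙ = Repaint.β R , Repaint.moves R ,
          ((λ i′ → Repaint.same R (same i′)) ,
           (λ i′ → repainted R (λ i x → phase i ≡ 1ℙ → x ≢ 0F)
              (λ { refl eq′ → contradiction (trans (sym eq) eq′) λ () }) (odds i′))) ,
          (λ _ → Repaint.colour₀ R) ,
          λ i′ → repainted R (λ i x → phase i ≡ 0ℙ → x ≡ 0F) (λ _ _ → refl)
        where
        R : Repaint α i 0F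
        R = repaint {α} {i} p (same i)
          (λ eq′ → odds (prev i) (trans (phase-prev i) (cong _⁻¹ eq)) (trans (same (prev i)) eq′))
          (odds (next i) (trans (phase-next i) (cong _⁻¹ eq)))

    -- Both neighbours of an odd blob are even and already wear 0, so 1 is available there.
    shade-odds : ∀ {α} → Proper G α → (∀ i → Same α i) × (∀ i → Shaded 0ℙ i α) →
                 ∃[ β ] (Star Move α β × ((∀ i → Same β i) × (∀ i → Shaded 0ℙ i β)) × (∀ i → Shaded 1ℙ i β))
    shade-odds = one-by-one Inv (Shaded 1ℙ) progress
      where
      Inv : Col → Set
      Inv α = (∀ i → Same α i) × (∀ i → Shaded 0ℙ i α)
      progress : ∀ i {α} → Proper G α → Inv α → Progress Inv (Shaded 1ℙ) i α
      progress i {α} p inv@(same , evens) with phase i in eq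
      ... | 0ℙ = α , ε , inv , (λ ()) , λ _ s → s
      ... | 1ℙ = Repaint.β R , Repaint.moves R ,
          ((λ i′ → Repaint.same R (same i′)) ,
           (λ i′ → repainted R (λ i x → phase i ≡ 0ℙ → x ≡ 0F)
              (λ { refl eq′ → contradiction (trans (sym eq) eq′) λ () }) (evens i′))) ,
          (λ _ → Repaint.colour₀ R) ,
          λ i′ → repainted R (λ i x → phase i ≡ 1ℙ → x ≡ 1F) (λ _ _ → refl)
        where
        0≢1 : ∀ {c : Fin q} → c ≡ 0F → c ≢ 1F
        0≢1 refl ()
        R : Repaint α i 1F
        R = repaint {α} {i} p (same i)
          (0≢1 (trans (sym (same (prev i))) (evens (prev i) (trans (phase-prev i) (cong _⁻¹ eq)))))
          (0≢1 (evens (next i) (trans (phase-next i) (cong _⁻¹ eq))))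

    Painted : Col → Set
    Painted α = ∀ i → α ⟨ i , 0F ⟩ ≡ shade (phase i) × α ⟨ i , 1F ⟩ ≡ shade (phase i)

    shaded⇒painted : ∀ {α} → (AllSame α × (∀ i → Shaded 0ℙ i α)) × (∀ i → Shaded 1ℙ i α) → Painted α
    shaded⇒painted {α} ((same , evens) , odds) i = colour₀ , trans (sym (same i)) colour₀
      where
      colour₀ : α ⟨ i , 0F ⟩ ≡ shade (phase i)
      colour₀ with phase i in eq
      ... | 0ℙ = evens i eq
      ... | 1ℙ = odds i eq

    paint : ∀ {α} → Proper G α → AllSame α → Reaches α Painted
    paint {α} p same =
      and-then {α} p (no-zero {α} p same) λ {β₁} p₁ (same₁ , nonzero) →
      and-then {β₁} p₁ (shade-evens {β₁} p₁ (same₁ , λ i _ → nonzero i)) λ {β₂} p₂ ((same₂ , _) , evens) →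
      and-then {β₂} p₂ (shade-odds {β₂} p₂ (same₂ , evens)) λ {β₃} p₃ shaded →
      β₃ , ε , shaded⇒painted {β₃} shaded

    -- Sorting the inner vertices and reaching the canonical colouring

    Sorted : Fin N × Fin (2 + r) → Col → Set
    Sorted (i , w) α = α ⟨ i , suc (suc w) ⟩ ≡ suc (suc w)

    shade≢ : ∀ b {w : Fin (2 + r)} → shade b ≢ suc (suc w)
    shade≢ 0ℙ ()
    shade≢ 1ℙ ()

    -- To place colour c at its own position, the vertex of the blob wearing c first steps aside to
    -- the missing colour. Vertices already sorted elsewhere wear other colours or lie in other
    -- blobs, and the painted ones wear 0 or 1, so none of these moves.
    sort : ∀ {α} → Proper G α → Painted α → ∃[ β ] (Star Move α β × Painted β × (∀ x → Sorted (remQuot {N} (2 + r) x) β))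
    sort = one-by-one Painted (Sorted ∘ remQuot {N} (2 + r))
      λ x {α} p painted → let β , moves , painted′ , sorted , keep = place (remQuot {N} (2 + r) x) {α} p painted
                      in β , moves , painted′ , sorted , λ x′ → keep (remQuot {N} (2 + r) x′)
      where
      place : ∀ x {α} → Proper G α → Painted α →
              ∃[ β ] (Star Move α β × Painted β × Sorted x β × (∀ x′ → Sorted x′ α → Sorted x′ β))
      place (i , w) {α} p painted = γ , moves ◅◅ ((vertex i c , c , absent {β} (λ j _ → free j) (λ ()) (λ ()) , refl) ◅ ε) ,
        (λ i′ → paint-kept i′ 0F (λ ()) (shade≢ (phase i′)) (proj₁ (painted i′)) ,
                paint-kept i′ 1F (λ ()) (shade≢ (phase i′)) (proj₂ (painted i′))) ,
        set-same β i c c ,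
        λ (i′ , w′) eq → sort-kept i′ w′ eq
        where
        c : Fin q
        c = suc (suc w)
        open FreeColour (free-colour {α} {i} {c} p (trans (proj₁ (painted i)) (sym (proj₂ (painted i))))
          (λ eq → shade≢ (phase i) (trans (sym (proj₁ (painted i))) eq)))
        γ : Col
        γ = β [ vertex i c ]≔ c
        paint-kept : ∀ i′ j {x} → j ≢ c → x ≢ c → α ⟨ i′ , j ⟩ ≡ x → γ ⟨ i′ , j ⟩ ≡ x
        paint-kept i′ j j≢c x≢c refl with i′ ≟ i
        ... | yes refl = trans (set-position β i c i j≢c) (unaffected j x≢c)
        ... | no i′≢i  = trans (set-blob β c c j i′≢i) (elsewhere j i′≢i)
        sort-kept : ∀ i′ w′ → Sorted (i′ , w′) α → Sorted (i′ , w′) γ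
        sort-kept i′ w′ eq with w′ ≟ w
        ... | no w′≢w  = paint-kept i′ (suc (suc w′)) (w′≢w ∘ suc-injective ∘ suc-injective)
          (w′≢w ∘ suc-injective ∘ suc-injective) eq
        ... | yes refl with i′ ≟ i
        ...   | yes refl = set-same β i c c
        ...   | no i′≢i  = trans (set-blob β c c c i′≢i) (trans (elsewhere c i′≢i) eq)

    Canonical : Col → Set
    Canonical α = Painted α × (∀ i w → Sorted (i , w) α)

    canonicalise : ∀ {α} → Proper G α → ¬ Frozen G α → Reaches α Canonical
    canonicalise {α} p ¬frozen =
      and-then {α} p (some-same {α} p ¬frozen) λ {β₁} p₁ (i , sameᵢ) →
      and-then {β₁} p₁ (all-same {β₁} p₁ i sameᵢ) λ {β₂} p₂ same →
      and-then {β₂} p₂ (paint {β₂} p₂ same) λ {β₃} p₃ painted →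
      and-then {β₃} p₃ (sort {β₃} p₃ painted) λ {β₄} _ (painted′ , sorted) →
      β₄ , ε , painted′ , λ i w → subst (λ x → Sorted x β₄) (remQuot-combine i w) (sorted (combine i w))

    canonical-unique : ∀ {α β} → Canonical α → Canonical β → α ≡ β
    canonical-unique {α} {β} (painted , sorted) (painted′ , sorted′) = vec-ext same
      where
      agree : ∀ i j → α ⟨ i , j ⟩ ≡ β ⟨ i , j ⟩
      agree i 0F            = trans (proj₁ (painted i)) (sym (proj₁ (painted′ i)))
      agree i 1F            = trans (proj₂ (painted i)) (sym (proj₂ (painted′ i)))
      agree i (suc (suc w)) = trans (sorted i w) (sym (sorted′ i w))
      same : ∀ v → lookup α v ≡ lookup β v
      same v with vertex-surjective v
      ... | i , j , refl = trans (lookup-vertex α i j) (trans (agree i j) (sym (lookup-vertex β i j)))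

    -- Both colourings move to the one canonical colouring, and moves are reversible.
    connected : ∀ {α β} → Proper G α → ¬ Frozen G α → Proper G β → ¬ Frozen G β → Star Move α β
    connected {α} {β} p ¬f p′ ¬f′ = meet (canonicalise {α} p ¬f) (canonicalise {β} p′ ¬f′)
      where
      meet : Reaches α Canonical → Reaches β Canonical → Star Move α β
      meet (γ , moves , can) (γ′ , moves′ , can′) with canonical-unique {γ} {γ′} can can′
      ... | refl = moves ◅◅ star-sym p′ moves′

-- The interval of intact blobs, its erosion, and the starting colouring

module Fronts where

  open import Data.Nat.Base using (z≤n; s≤s; _+_; _*_; _≤_; _<_; _^_)
  import Data.Nat.Properties as ℕ
  open import Data.Nat.Solver using (module +-*-Solver)
  open import Data.Vec.Base using (_[_]≔_)
  open GlauberDynamics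
  open Necklaces
  open Connectedness

  -- Converts the bound k · n · q / 8 into the stated one: n² = 2k · n · q, and 2 ≤ q.
  square≤ : ∀ n N q k → n ≡ N * q → N ≡ k + k → 2 ≤ q → n ^ 2 ≤ q * (k * (n * q))
  square≤ n N q k n≡ N≡ 2≤q = begin
    n ^ 2                 ≡⟨ cong (n *_) (ℕ.*-identityʳ n) ⟩
    n * n                 ≡⟨ cong (n *_) (trans n≡ (cong (_* q) N≡)) ⟩
    n * ((k + k) * q)     ≡⟨ cong (λ e → n * ((k + e) * q)) (ℕ.+-identityʳ k) ⟨
    n * (2 * k * q)       ≤⟨ ℕ.*-monoʳ-≤ n (ℕ.*-monoˡ-≤ q (ℕ.*-monoˡ-≤ k 2≤q)) ⟩
    n * (q * k * q)       ≡⟨ solve 3 (λ n q k → n :* (q :* k :* q) := q :* (k :* (n :* q))) refl n q k ⟩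
    q * (k * (n * q))     ∎
    where
    open ℕ.≤-Reasoning
    open +-*-Solver

  module Front (N-2 r : ℕ) (odd : ℕ.parity (suc N-2) ≡ 1ℙ) (k : ℕ) (N≡2k : suc (suc N-2) ≡ k + k) where
    open Necklace N-2 (suc r)
    open Connectivity N-2 r odd using (Col; Same; blob-full)
    open Moves G {q}

    Intact : Col → Fin N → Set
    Intact α i = α ⟨ i , 0F ⟩ ≡ 0F × α ⟨ i , 1F ⟩ ≡ 1F

    intact? : ∀ α i → Dec (Intact α i)
    intact? α i = (α ⟨ i , 0F ⟩ ≟ 0F) ×-dec (α ⟨ i , 1F ⟩ ≟ 1F)

    -- |i − k| < d, stated without subtraction.
    Clear : Col → ℕ → Set
    Clear α d = ∀ i → k < toℕ i + d → toℕ i < k + d → Intact α i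

    clear? : ∀ α d → Dec (Clear α d)
    clear? α d = all? λ i → (k ℕ.<? toℕ i + d) →-dec ((toℕ i ℕ.<? k + d) →-dec intact? α i)

    clear-zero : ∀ α → Clear α 0
    clear-zero α i k<i i<k = contradiction
      (ℕ.<-trans (subst (k <_) (ℕ.+-identityʳ (toℕ i)) k<i) (subst (toℕ i <_) (ℕ.+-identityʳ k) i<k)) (ℕ.n≮n k)

    -- A downward search for the largest clear radius; radius 0 is always clear. The cap k used in
    -- `radius` keeps blob 0 outside every zone, so a zone never closes up around the cycle.
    radiusUpTo : ℕ → Col → ℕ
    radiusUpTo zero    α = 0
    radiusUpTo (suc m) α with clear? α (suc m)
    ... | yes _ = suc m
    ... | no _  = radiusUpTo m α

    radius : Col → ℕ
    radius = radiusUpTo k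

    radiusUpTo-≤ : ∀ m α → radiusUpTo m α ≤ m
    radiusUpTo-≤ zero    α = z≤n
    radiusUpTo-≤ (suc m) α with clear? α (suc m)
    ... | yes _ = ℕ.≤-refl
    ... | no _  = ℕ.m≤n⇒m≤1+n (radiusUpTo-≤ m α)

    clear-radiusUpTo : ∀ m α → Clear α (radiusUpTo m α)
    clear-radiusUpTo zero    α = clear-zero α
    clear-radiusUpTo (suc m) α with clear? α (suc m)
    ... | yes clear = clear
    ... | no _      = clear-radiusUpTo m α

    radiusUpTo-max : ∀ m {α d} → d ≤ m → Clear α d → d ≤ radiusUpTo m α
    radiusUpTo-max zero    d≤m clear = d≤m
    radiusUpTo-max (suc m) {α} {d} d≤1+m clear with clear? α (suc m)
    ... | yes _ = d≤1+m
    ... | no ¬clear with ℕ.m≤n⇒m<n∨m≡n d≤1+m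
    ...   | inj₁ (s≤s d≤m) = radiusUpTo-max m d≤m clear
    ...   | inj₂ refl      = contradiction clear ¬clear

    -- An intact blob shows all colours, so a new colour available to u or v must sit on the other
    -- of the two, which is its only non-neighbour in the blob.
    locked : ∀ {α i} j c → Proper G α → Intact α i → ¬ Appears G α (vertex i j) c → part j ≡ 0F → α ⟨ i , j ⟩ ≢ c →
             (j ≡ 0F × c ≡ 1F) ⊎ (j ≡ 1F × c ≡ 0F)
    locked {α} {i} j c p (u≡0 , v≡1) ∄u j~0 α≢c with blob-full {α} {i} p (λ same → 0≢1 (trans (sym u≡0) (trans same v≡1))) c
      where
      0≢1 : 0F ≢ 1F
      0≢1 ()
    ... | j′ , eq with part j ≟ part j′
    ...   | no j≢j′  = contradiction eq (absent-inner {α} {i} {j} ∄u j′ j≢j′)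
    ...   | yes j~j′ with part-fibre j j′ j~j′
    ...     | inj₁ refl                 = contradiction eq α≢c
    ...     | inj₂ (inj₁ (refl , refl)) = inj₁ (refl , trans (sym eq) v≡1)
    ...     | inj₂ (inj₂ (refl , refl)) = inj₂ (refl , trans (sym eq) u≡0)

    -- The two harmful moves for a zone of radius d + 1: in an extreme blob, the vertex linked to
    -- the outside copies the colour of its partner.
    data Front (d : ℕ) : Fin N → Fin q → Fin q → Set where
      right : ∀ {i} → toℕ i ≡ k + d → Front d i 1F 0F
      left  : ∀ {i} → toℕ i + d ≡ k → Front d i 0F 1F

    module _ {α d} (p : Proper G α) (clear : Clear α (suc d)) (1+d≤k : suc d ≤ k) where

      -- If i were not leftmost, the preceding blob would belong to the zone and its v would wear 1.
      left-end : ∀ {i} → k < toℕ i + suc d → toℕ i < k + suc d → α ⟨ prev i , 1F ⟩ ≢ 1F → toℕ i + d ≡ k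
      left-end {i} k<i i<k damaged with ℕ.m≤n⇒m<n∨m≡n (ℕ.≤-pred (subst (k <_) (ℕ.+-suc (toℕ i) d) k<i))
      ... | inj₂ k≡i+d = sym k≡i+d
      ... | inj₁ k<i+d = contradiction (proj₂ (clear (prev i)
          (subst (k <_) (trans (cong (_+ d) (sym prev-i)) (sym (ℕ.+-suc (toℕ (prev i)) d))) k<i+d)
          (ℕ.<-trans (subst (toℕ (prev i) <_) prev-i (ℕ.n<1+n _)) i<k))) damaged
        where
        -- Since d + 1 ≤ k, blob 0 lies outside the zone and `prev` does not wrap around.
        0<i : 0 < toℕ i
        0<i = ℕ.+-cancelʳ-< (suc d) 0 (toℕ i) (ℕ.≤-<-trans 1+d≤k k<i)
        prev-i : suc (toℕ (prev i)) ≡ toℕ i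
        prev-i = toℕ-prev i 0<i

      right-end : ∀ {i} → k < toℕ i + suc d → toℕ i < k + suc d → α ⟨ next i , 0F ⟩ ≢ 0F → toℕ i ≡ k + d
      right-end {i} k<i i<k damaged with ℕ.m≤n⇒m<n∨m≡n (ℕ.≤-pred (subst (toℕ i <_) (ℕ.+-suc k d) i<k))
      ... | inj₂ i≡k+d = i≡k+d
      ... | inj₁ i<k+d = contradiction (proj₁ (clear (next i)
          (subst (λ e → k < e + suc d) (sym next-i) (ℕ.m<n⇒m<1+n k<i))
          (subst (_< k + suc d) (sym next-i) 1+i<))) damaged
        where
        1+i< : suc (toℕ i) < k + suc d
        1+i< = subst (suc (toℕ i) <_) (sym (ℕ.+-suc k d)) (s≤s i<k+d)
        -- Likewise i + 1 < k + (d + 1) ≤ 2k, so `next` does not wrap around.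
        next-i : toℕ (next i) ≡ suc (toℕ i)
        next-i = toℕ-next i (subst (suc (toℕ i) <_) (sym N≡2k) (ℕ.<-≤-trans 1+i< (ℕ.+-monoʳ-≤ k 1+d≤k)))

      module _ (i : Fin N) (j c : Fin q) where

        β : Col
        β = α [ vertex i j ]≔ c

        -- The move touches only blob i, so a smaller or equal zone can fail to be clear only there.
        clear-unless : ∀ {e} → e ≤ suc d → (k < toℕ i + e → toℕ i < k + e → Intact β i) → Clear β e
        clear-unless {e} e≤1+d unless i′ k<i′ i′<k with i′ ≟ i
        ... | yes refl = unless k<i′ i′<k
        ... | no i′≢i  = trans (set-blob α j c 0F i′≢i) (proj₁ intact) , trans (set-blob α j c 1F i′≢i) (proj₂ intact)
          where
          intact : Intact α i′
          intact = clear i′ (ℕ.≤-trans k<i′ (ℕ.+-monoʳ-≤ (toℕ i′) e≤1+d)) (ℕ.≤-trans i′<k (ℕ.+-monoʳ-≤ k e≤1+d))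

        -- Moves outside the zone, at inner positions, or to the present colour are harmless. Any
        -- other is forced by `locked` and needs a damaged link neighbour, so it happens at an end.
        -- The zone of radius d has strict bounds and just excludes that end blob.
        front-step : ¬ Appears G α (vertex i j) c → Clear β (suc d) ⊎ (Clear β d × Front d i j c)
        front-step ∄u with k ℕ.<? toℕ i + suc d | toℕ i ℕ.<? k + suc d
        ... | no k≮i  | _       = inj₁ (clear-unless ℕ.≤-refl λ k<i _ → contradiction k<i k≮i)
        ... | yes _   | no i≮k  = inj₁ (clear-unless ℕ.≤-refl λ _ i<k → contradiction i<k i≮k)
        ... | yes k<i | yes i<k with part j ≟ 0F | α ⟨ i , j ⟩ ≟ c
        ...   | no j≁0 | _ = inj₁ (clear-unless ℕ.≤-refl λ _ _ →
                  trans (set-position α i c i (λ { refl → j≁0 refl })) (proj₁ (clear i k<i i<k)) ,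
                  trans (set-position α i c i (λ { refl → j≁0 refl })) (proj₂ (clear i k<i i<k)))
        ...   | yes _  | yes refl = inj₁ (clear-unless ℕ.≤-refl λ _ _ →
                  trans (unchanged 0F) (proj₁ (clear i k<i i<k)) , trans (unchanged 1F) (proj₂ (clear i k<i i<k)))
          where
          unchanged : ∀ j′ → (α [ vertex i j ]≔ α ⟨ i , j ⟩) ⟨ i , j′ ⟩ ≡ α ⟨ i , j′ ⟩
          unchanged j′ with j′ ≟ j
          ... | yes refl = set-same α i j (α ⟨ i , j ⟩)
          ... | no j′≢j  = set-position α i (α ⟨ i , j ⟩) i j′≢j
        ...   | yes j~0 | no α≢c with locked {α} {i} j c p (clear i k<i i<k) ∄u j~0 α≢c
        ...     | inj₁ (refl , refl) = let end = left-end k<i i<k (absent-prev {α} {i} {j} ∄u refl) in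
                  inj₂ (clear-unless (ℕ.n≤1+n d) (λ k<i+d _ → contradiction (subst (k <_) end k<i+d) (ℕ.n≮n k)) , left end)
        ...     | inj₂ (refl , refl) = let end = right-end k<i i<k (absent-next {α} {i} {j} ∄u refl) in
                  inj₂ (clear-unless (ℕ.n≤1+n d)
                    (λ _ i<k+d → contradiction (subst (_< k + d) end i<k+d) (ℕ.n≮n (k + d))) , right end)

    -- `swap₀₁` is the symmetry that bounds the stationary measure; `swap₀₂` produces the single
    -- damaged blob of the starting colouring.
    swap₀₁ swap₀₂ : Fin q → Fin q
    swap₀₁ 0F            = 1F
    swap₀₁ 1F            = 0F
    swap₀₁ (suc (suc c)) = suc (suc c)
    swap₀₂ 0F            = 2F
    swap₀₂ 1F            = 1F
    swap₀₂ 2F            = 0F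
    swap₀₂ (suc (suc (suc c))) = suc (suc (suc c))

    swap₀₁-involutive : ∀ c → swap₀₁ (swap₀₁ c) ≡ c
    swap₀₁-involutive 0F            = refl
    swap₀₁-involutive 1F            = refl
    swap₀₁-involutive (suc (suc c)) = refl

    swap₀₂-involutive : ∀ c → swap₀₂ (swap₀₂ c) ≡ c
    swap₀₂-involutive 0F                  = refl
    swap₀₂-involutive 1F                  = refl
    swap₀₂-involutive 2F                  = refl
    swap₀₂-involutive (suc (suc (suc c))) = refl

    -- Blob 0, opposite blob k, has colour 2 on its u. Hence v of the preceding blob sees no 0, and
    -- the colouring is not frozen although every blob shows all colours.
    start : Fin N → Fin q → Fin q
    start zero    j = swap₀₂ j
    start (suc i) j = j

    start-injective : ∀ i {j j′} → start i j ≡ start i j′ → j ≡ j′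
    start-injective zero    {j} {j′} eq = trans (sym (swap₀₂-involutive j)) (trans (cong swap₀₂ eq) (swap₀₂-involutive j′))
    start-injective (suc i) eq = eq

    α₀ : Col
    α₀ = fill start

    start-1 : ∀ i → start i 1F ≡ 1F
    start-1 zero    = refl
    start-1 (suc i) = refl

    start-0≢1 : ∀ i → start i 0F ≢ 1F
    start-0≢1 zero    ()
    start-0≢1 (suc i) ()

    -- Inside a blob the colouring is a permutation; across links, every v wears 1 and no u does.
    α₀-proper : Proper G α₀
    α₀-proper = toProper {α₀}
      (λ i j j′ j≢j′ eq → j≢j′ (cong part (start-injective i (trans (sym (fill-⟨⟩ start i j)) (trans eq (fill-⟨⟩ start i j′))))))
      (λ i eq → start-0≢1 (next i)
        (trans (sym (fill-⟨⟩ start (next i) 0F)) (trans (sym eq) (trans (fill-⟨⟩ start i 1F) (start-1 i)))))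

    α₀-nonFrozen : ¬ Frozen G α₀
    α₀-nonFrozen = nonFrozen-witness {α₀} {vertex (prev zero) 1F} {0F}
      (absent {α₀} {prev zero} {1F} {0F}
        (λ j j≁1 eq → j≁1 (sym (cong part (trans (sym (fill-⟨⟩ start (prev zero) j)) eq))))
        (λ _ eq → 2≢0 (trans (sym (fill-⟨⟩ start zero 0F)) (trans (cong (λ i → α₀ ⟨ i , 0F ⟩) (sym (next-prev zero))) eq)))
        (λ ()))
      (λ eq → 1≢0 (trans (sym (fill-⟨⟩ start (prev zero) 1F)) (trans (sym (lookup-vertex α₀ (prev zero) 1F)) eq)))
      where
      1≢0 : _≢_ {A = Fin q} 1F 0F
      1≢0 ()
      2≢0 : _≢_ {A = Fin q} 2F 0F
      2≢0 ()

    α₀-radius : k ≤ radius α₀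
    α₀-radius = radiusUpTo-max k ℕ.≤-refl clear
      where
      clear : Clear α₀ k
      clear zero    k<k _ = contradiction k<k (ℕ.n≮n k)
      clear (suc i) _   _ = fill-⟨⟩ start (suc i) 0F , fill-⟨⟩ start (suc i) 1F

-- The lower bound on the mixing time

module SlowMixing where

  open import Data.Nat.Base using (z≤n; s≤s)
  import Data.Nat.Properties as ℕ
  open import Data.Integer.Base using (+_)
  open import Data.Fin.Subset using (Subset)
  open import Data.Vec.Base as Vec using (Vec; lookup; _[_]≔_; tabulate)
  open import Data.Rational.Base
  open import Data.Rational.Properties hiding (_≟_)
  open import Data.Rational.Solver
  open import Algebra.Properties.CommutativeMonoid.Sum +-0-commutativeMonoid
  open RationalSums
  open MarkovChains
  open GlauberDynamics
  open Necklaces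
  open Connectedness
  open Fronts
  open +-*-Solver

  fromℕ-keep : ∀ {a b ℓ} → a ℕ.≤ b → 0ℚ ≤ ℓ → fromℕ a ≤ fromℕ b + ℓ
  fromℕ-keep {a} {b} a≤b 0≤ℓ = subst (_≤ _) (+-identityʳ (fromℕ a)) (+-mono-≤ (fromℕ-mono {a} {b} a≤b) 0≤ℓ)

  fromℕ-drop : ∀ {a b ℓ} → a ℕ.≤ b → 1ℚ ≤ ℓ → fromℕ (suc a) ≤ fromℕ b + ℓ
  fromℕ-drop {a} {b} a≤b 1≤ℓ = subst (_≤ _) (trans (+-comm (fromℕ a) 1ℚ) (sym (fromℕ-+ 1 a))) (+-mono-≤ (fromℕ-mono {a} {b} a≤b) 1≤ℓ)

  /-≤-fromℕ : ∀ a b t .{{_ : ℕ.NonZero b}} → fromℕ a ≤ fromℕ (b ℕ.* t) → + a / b ≤ fromℕ t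
  /-≤-fromℕ a b t a≤bt = *-cancelˡ-≤-pos (fromℕ b) {{normalize-pos b 1}} (begin
    fromℕ b * (+ a / b)     ≡⟨ fromℕ-*-/ a b ⟩
    fromℕ a                 ≤⟨ a≤bt ⟩
    fromℕ (b ℕ.* t)         ≡⟨ fromℕ-* b t ⟩
    fromℕ b * fromℕ t       ∎)
    where open ≤-Reasoning

  square-bound : ∀ n N q k t → n ≡ N ℕ.* q → N ≡ k ℕ.+ k → 2 ℕ.≤ q → fromℕ (k ℕ.* (n ℕ.* q)) ≤ fromℕ (8 ℕ.* t) →
                 fromℕ (n ℕ.^ 2) ≤ fromℕ (8 ℕ.* q ℕ.* t)
  square-bound n N q k t n≡ N≡ 2≤q knq≤8t = begin
    fromℕ (n ℕ.^ 2)                      ≤⟨ fromℕ-mono {n ℕ.^ 2} {q ℕ.* (k ℕ.* (n ℕ.* q))} (square≤ n N q k n≡ N≡ 2≤q) ⟩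
    fromℕ (q ℕ.* (k ℕ.* (n ℕ.* q)))      ≡⟨ fromℕ-* q (k ℕ.* (n ℕ.* q)) ⟩
    fromℕ q * fromℕ (k ℕ.* (n ℕ.* q))    ≤⟨ *-monoˡ-≤′ (0≤fromℕ q) knq≤8t ⟩
    fromℕ q * fromℕ (8 ℕ.* t)            ≡⟨ fromℕ-* q (8 ℕ.* t) ⟨
    fromℕ (q ℕ.* (8 ℕ.* t))              ≡⟨ cong fromℕ (trans (sym (ℕ.*-assoc q 8 t)) (cong (ℕ._* t) (ℕ.*-comm q 8))) ⟩
    fromℕ (8 ℕ.* q ℕ.* t)                ∎
    where
    open ≤-Reasoning

  module LowerBound (N-2 r : ℕ) (odd : ℕ.parity (suc N-2) ≡ 1ℙ) (k : ℕ) (N≡2k : suc (suc N-2) ≡ k ℕ.+ k) where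
    open Necklace N-2 (suc r)
    open Connectivity N-2 r odd using (Col)
    open Front N-2 r odd k N≡2k
    open Moves G {q}
    open NonFrozenChain G {q} (vertex zero 0F) 0F
    open Chain P stochastic

    n : ℕ
    n = N ℕ.* q

    w : ℚ
    w = weight (vertex zero 0F) 0F

    0<k : 0 ℕ.< k
    0<k = ℕ.n≢0⇒n>0 λ { refl → contradiction N≡2k λ () }

    f : State → ℚ
    f x = fromℕ (radius (colouring x))

    point : Fin n → Fin q → Fin n → Fin q → ℚ
    point v₁ c₁ v c = indicator (v₁ ≟ v) * indicator (c₁ ≟ c)

    0≤point : ∀ v₁ c₁ v c → 0ℚ ≤ point v₁ c₁ v c
    0≤point v₁ c₁ v c = 0≤*0≤ (0≤indicator (v₁ ≟ v)) (0≤indicator (c₁ ≟ c))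

    point-diagonal : ∀ v c → point v c v c ≡ 1ℚ
    point-diagonal v c = cong₂ _*_ (indicator-yes (v ≟ v) refl) (indicator-yes (c ≟ c) refl)

    ∑point : ∀ v₁ c₁ → ∑[ v < n ] ∑[ c < q ] (weight v c * point v₁ c₁ v c) ≡ w
    ∑point v₁ c₁ = begin
      ∑[ v < n ] ∑[ c < q ] (weight v c * point v₁ c₁ v c)
        ≡⟨ sum-cong-≗ {n} (λ v → sum-cong-≗ {q} (λ c → trans
             (cong (_* point v₁ c₁ v c) (cong₂ _*_ (uniform-const v (vertex zero 0F)) (uniform-const c 0F)))
             (solve 3 (λ w a b → w :* (a :* b) := a :* (b :* w)) refl w (indicator (v₁ ≟ v)) (indicator (c₁ ≟ c))))) ⟩
      ∑[ v < n ] ∑[ c < q ] (indicator (v₁ ≟ v) * (indicator (c₁ ≟ c) * w))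
        ≡⟨ sum-cong-≗ {n} (λ v → trans (sym (*-distribˡ-∑ {q} (indicator (v₁ ≟ v)) (λ c → indicator (c₁ ≟ c) * w)))
                                   (cong (indicator (v₁ ≟ v) *_) (∑-indicator c₁ (λ _ → w)))) ⟩
      ∑[ v < n ] (indicator (v₁ ≟ v) * w)
        ≡⟨ ∑-indicator v₁ (λ _ → w) ⟩
      w ∎
      where open ≡-Reasoning

    -- The bound on each single choice is averaged over all choices, whose weights sum to 1.
    average-drop : ∀ x (loss : Fin n → Fin q → ℚ) → (∀ v c → f x ≤ f (step x v c) + loss v c) →
                   ∀ {ε} → ∑[ v < n ] ∑[ c < q ] (weight v c * loss v c) ≡ ε → f x - ε ≤ average f x
    average-drop x loss f≤ {ε} ∑loss = 0≤q-p⇒p≤q (subst (0ℚ ≤_)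
      (solve 3 (λ a e f → (a :+ e) :- f := a :- (f :- e)) refl (average f x) ε (f x)) (p≤q⇒0≤q-p (begin
      f x
        ≡⟨ *-identityˡ (f x) ⟨
      1ℚ * f x
        ≡⟨ cong (_* f x) ∑weight ⟨
      (∑[ v < n ] ∑[ c < q ] weight v c) * f x
        ≡⟨ trans (*-distribʳ-∑ {n} (f x) (λ v → ∑[ c < q ] weight v c)) (sum-cong-≗ {n} (λ v → *-distribʳ-∑ {q} (f x) (weight v))) ⟩
      ∑[ v < n ] ∑[ c < q ] (weight v c * f x)
        ≤⟨ ∑-mono {n} (λ v → ∑-mono {q} (λ c → *-monoˡ-≤′ (0≤weight v c) (f≤ v c))) ⟩
      ∑[ v < n ] ∑[ c < q ] (weight v c * (f (step x v c) + loss v c))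
        ≡⟨ sum-cong-≗ {n} (λ v → trans (sum-cong-≗ {q} (λ c → *-distribˡ-+ (weight v c) (f (step x v c)) (loss v c)))
             (∑-distrib-+ {q} (λ c → weight v c * f (step x v c)) (λ c → weight v c * loss v c))) ⟩
      ∑[ v < n ] (∑[ c < q ] (weight v c * f (step x v c)) + ∑[ c < q ] (weight v c * loss v c))
        ≡⟨ ∑-distrib-+ {n} (λ v → ∑[ c < q ] (weight v c * f (step x v c))) (λ v → ∑[ c < q ] (weight v c * loss v c)) ⟩
      ∑[ v < n ] ∑[ c < q ] (weight v c * f (step x v c)) + ∑[ v < n ] ∑[ c < q ] (weight v c * loss v c)
        ≡⟨ cong₂ _+_ (sym (P-average f x)) ∑loss ⟩
      average f x + ε ∎)))
      where open ≤-Reasoning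

    -- The extreme blobs of a clear zone of radius d + 1, the right one first.
    ends : ∀ d → suc d ℕ.≤ k → Fin N × Fin N
    ends d d<k = fromℕ< {k ℕ.+ d} (subst (k ℕ.+ d ℕ.<_) (sym N≡2k) (ℕ.+-monoʳ-< k d<k)) ,
                 fromℕ< {k ℕ.∸ d} (subst (k ℕ.∸ d ℕ.<_) (sym N≡2k) (ℕ.≤-<-trans (ℕ.m∸n≤m k d) (ℕ.m<m+n k 0<k)))

    -- Only two of the n·q choices of the dynamics can shrink a clear zone of positive radius.
    loss : ∀ d → suc d ℕ.≤ k → Fin n → Fin q → ℚ
    loss d d<k v c = point (vertex (proj₁ (ends d d<k)) 1F) 0F v c + point (vertex (proj₂ (ends d d<k)) 0F) 1F v c

    0≤loss : ∀ d d<k v c → 0ℚ ≤ loss d d<k v c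
    0≤loss d d<k v c = 0≤+0≤ (0≤point (vertex (proj₁ (ends d d<k)) 1F) 0F v c) (0≤point (vertex (proj₂ (ends d d<k)) 0F) 1F v c)

    front-loss : ∀ {d} d<k {i j c} → Front d i j c → 1ℚ ≤ loss d d<k (vertex i j) c
    front-loss {d} d<k {i} (right i≡k+d) = begin
      1ℚ + 0ℚ                                ≤⟨ +-mono-≤ (≤-reflexive (sym (trans
        (cong (λ i₁ → point (vertex i₁ 1F) 0F (vertex i 1F) 0F) (toℕ-injective (trans (toℕ-fromℕ< _) (sym i≡k+d))))
        (point-diagonal (vertex i 1F) 0F)))) (0≤point (vertex (proj₂ (ends d d<k)) 0F) 1F (vertex i 1F) 0F) ⟩
      loss d d<k (vertex i 1F) 0F            ∎
      where open ≤-Reasoning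
    front-loss {d} d<k {i} (left i+d≡k) = begin
      0ℚ + 1ℚ                                ≤⟨ +-mono-≤ (0≤point (vertex (proj₁ (ends d d<k)) 1F) 0F (vertex i 0F) 1F)
        (≤-reflexive (sym (trans
        (cong (λ i₁ → point (vertex i₁ 0F) 1F (vertex i 0F) 1F) (toℕ-injective (trans (toℕ-fromℕ< _)
          (trans (cong (ℕ._∸ d) (sym i+d≡k)) (ℕ.m+n∸n≡m (toℕ i) d)))))
        (point-diagonal (vertex i 0F) 1F)))) ⟩
      loss d d<k (vertex i 0F) 1F            ∎
      where open ≤-Reasoning

    -- The zone surviving the step bounds the new radius from below by maximality, and a shrinkage
    -- by 1 is paid for by `front-loss`.
    glauberStep-loss : ∀ α d (d<k : suc d ℕ.≤ k) → Proper G α → Clear α (suc d) → ∀ v c →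
                       fromℕ (suc d) ≤ fromℕ (radius (glauberStep G α v c)) + loss d d<k v c
    glauberStep-loss α d d<k p clear v c = cases (step-cases α v c) (vertex-surjective v)
      where
      Goal : Col → Fin n → Set
      Goal β v = fromℕ (suc d) ≤ fromℕ (radius β) + loss d d<k v c
      front : ∀ i j → Clear (α [ vertex i j ]≔ c) (suc d) ⊎ (Clear (α [ vertex i j ]≔ c) d × Front d i j c) →
              Goal (α [ vertex i j ]≔ c) (vertex i j)
      front i j (inj₁ clear′)         = fromℕ-keep {suc d} {radius (α [ vertex i j ]≔ c)}
        (radiusUpTo-max k d<k clear′) (0≤loss d d<k (vertex i j) c)
      front i j (inj₂ (clear′ , fr))  = fromℕ-drop {d} {radius (α [ vertex i j ]≔ c)}
        (radiusUpTo-max k (ℕ.<⇒≤ d<k) clear′) (front-loss d<k fr)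
      cases : (¬ Appears G α v c × glauberStep G α v c ≡ α [ v ]≔ c) ⊎ (glauberStep G α v c ≡ α) →
              ∃[ i ] ∃[ j ] vertex i j ≡ v → Goal (glauberStep G α v c) v
      cases (inj₂ eq) _ = subst (λ β → Goal β v) (sym eq)
        (fromℕ-keep {suc d} {radius α} (radiusUpTo-max k d<k clear) (0≤loss d d<k v c))
      cases (inj₁ (∄u , eq)) (i , j , refl) = subst (λ β → Goal β v) (sym eq)
        (front i j (front-step {α} {d} p clear d<k i j c ∄u))

    -- Each of the two harmful choices has probability w = 1/(nq) and costs at most 1. At radius 0
    -- there is nothing to lose, and the average is non-negative.
    radius-drop : ∀ x → f x - (w + w) ≤ average f x
    radius-drop x = cases (radius (colouring x)) refl
      where
      open ≤-Reasoning
      cases : ∀ d → radius (colouring x) ≡ d → f x - (w + w) ≤ average f x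
      cases zero eq = begin
        f x - (w + w)     ≡⟨ cong (λ d → fromℕ d - (w + w)) eq ⟩
        0ℚ - (w + w)      ≤⟨ +-monoʳ-≤ 0ℚ (neg-antimono-≤ (0≤+0≤ (0≤weight (vertex zero 0F) 0F) (0≤weight (vertex zero 0F) 0F))) ⟩
        0ℚ                ≤⟨ 0≤∑ (λ y → 0≤*0≤ (0≤P x y) (0≤fromℕ (radius (colouring y)))) ⟩
        average f x       ∎
      cases (suc d) eq = average-drop x (loss d d<k) bound ∑loss
        where
        d<k : suc d ℕ.≤ k
        d<k = subst (ℕ._≤ k) eq (radiusUpTo-≤ k (colouring x))
        bound : ∀ v c → f x ≤ f (step x v c) + loss d d<k v c
        bound v c = subst₂ (λ a β → fromℕ a ≤ fromℕ (radius β) + loss d d<k v c) (sym eq) (sym (colouring-step x v c))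
          (glauberStep-loss (colouring x) d d<k (proper x) (subst (Clear (colouring x)) eq (clear-radiusUpTo k (colouring x))) v c)
        ∑loss : ∑[ v < n ] ∑[ c < q ] (weight v c * loss d d<k v c) ≡ w + w
        ∑loss = trans
          (sum-cong-≗ {n} (λ v → trans
            (sum-cong-≗ {q} (λ c → *-distribˡ-+ (weight v c) (point hi 0F v c) (point lo 1F v c)))
            (∑-distrib-+ {q} (λ c → weight v c * point hi 0F v c) (λ c → weight v c * point lo 1F v c))))
          (trans (∑-distrib-+ {n} (λ v → ∑[ c < q ] (weight v c * point hi 0F v c))
            (λ v → ∑[ c < q ] (weight v c * point lo 1F v c)))
                 (cong₂ _+_ (∑point hi 0F) (∑point lo 1F)))
          where
          hi lo : Fin n
          hi = vertex (proj₁ (ends d d<k)) 1F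
          lo = vertex (proj₂ (ends d d<k)) 0F

    x₀ : State
    x₀ = proj₁ (state α₀ α₀-proper α₀-nonFrozen)

    k≤fx₀ : fromℕ k ≤ f x₀
    k≤fx₀ = subst (λ α → fromℕ k ≤ fromℕ (radius α)) (sym (proj₂ (state α₀ α₀-proper α₀-nonFrozen)))
      (fromℕ-mono {k} {radius α₀} α₀-radius)

    middle : Fin N
    middle = fromℕ< {k} (subst (k ℕ.<_) (sym N≡2k) (ℕ.m<m+n k 0<k))

    A : Subset _
    A = tabulate (λ y → does (intact? (colouring y) middle))

    1A : State → ℚ
    1A y = if lookup A y then 1ℚ else 0ℚ

    -- Every zone of positive radius contains the middle blob, so a damaged middle forces radius 0.
    -- The right-hand side has the affine shape expected by `expect-affine`.
    f≤k1A : ∀ y → f y ≤ 0ℚ + fromℕ k * 1A y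
    f≤k1A y = subst (λ b → f y ≤ 0ℚ + fromℕ k * (if b then 1ℚ else 0ℚ)) (sym (lookup∘tabulate _ y))
        (cases (intact? (colouring y) middle))
      where
      open ≤-Reasoning
      cases : (D : Dec (Intact (colouring y) middle)) → f y ≤ 0ℚ + fromℕ k * (if does D then 1ℚ else 0ℚ)
      cases (yes _) = begin
        f y                      ≤⟨ fromℕ-mono {radius (colouring y)} {k} (radiusUpTo-≤ k (colouring y)) ⟩
        fromℕ k                  ≡⟨ solve 1 (λ k → k := con 0ℚ :+ k :* con 1ℚ) refl (fromℕ k) ⟩
        0ℚ + fromℕ k * 1ℚ        ∎
      cases (no damaged) = begin
        f y                      ≡⟨ cong fromℕ (zero-radius (radius (colouring y)) refl) ⟩
        0ℚ                       ≡⟨ solve 1 (λ k → con 0ℚ := con 0ℚ :+ k :* con 0ℚ) refl (fromℕ k) ⟩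
        0ℚ + fromℕ k * 0ℚ        ∎
        where
        zero-radius : ∀ d → radius (colouring y) ≡ d → d ≡ 0
        zero-radius zero    eq = refl
        zero-radius (suc d) eq = contradiction
          (subst (Clear (colouring y)) eq (clear-radiusUpTo k (colouring y)) middle
            (subst (λ m → k ℕ.< m ℕ.+ suc d) (sym (toℕ-fromℕ< _)) (ℕ.m<m+n k (s≤s z≤n)))
            (subst (λ m → m ℕ.< k ℕ.+ suc d) (sym (toℕ-fromℕ< _)) (ℕ.m<m+n k (s≤s z≤n)))) damaged

    swapped : ∀ x → ∃[ y ] colouring y ≡ Vec.map swap₀₁ (colouring x)
    swapped x = state (Vec.map swap₀₁ (colouring x)) (map-proper swap₀₁-involutive (colouring x) (proper x))
      (map-nonFrozen swap₀₁-involutive (colouring x) (nonFrozen x))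

    swap : State → State
    swap x = proj₁ (swapped x)

    colouring-swap : ∀ x → colouring (swap x) ≡ Vec.map swap₀₁ (colouring x)
    colouring-swap x = proj₂ (swapped x)

    swap-involutive : ∀ x → swap (swap x) ≡ x
    swap-involutive x = colouring-injective (trans (colouring-swap (swap x))
      (trans (cong (Vec.map swap₀₁) (colouring-swap x)) (map-involutive swap₀₁-involutive (colouring x))))

    -- Where the middle blob is intact, exchanging the colours 0 and 1 puts 1 on its u, so A is
    -- disjoint from its image.
    measure-A : measure uniform A ≤ ½
    measure-A = measure≤½ A swap swap-involutive disjoint x₀
      where
      intact⁻ : ∀ {α} (D : Dec (Intact α middle)) → does D ≡ true → Intact α middle
      intact⁻ (yes intact) _ = intact
      damaged : ∀ x → Intact (colouring x) middle → ¬ Intact (colouring (swap x)) middle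
      damaged x (u≡0 , _) (u≡0′ , _) = 1F≢0F (begin
        1F                                              ≡⟨ cong swap₀₁ u≡0 ⟨
        swap₀₁ (colouring x ⟨ middle , 0F ⟩)            ≡⟨ cong swap₀₁ (lookup-vertex (colouring x) middle 0F) ⟨
        swap₀₁ (lookup (colouring x) (vertex middle 0F)) ≡⟨ lookup-map (vertex middle 0F) swap₀₁ (colouring x) ⟨
        lookup (Vec.map swap₀₁ (colouring x)) (vertex middle 0F) ≡⟨ cong (λ α → lookup α (vertex middle 0F)) (colouring-swap x) ⟨
        lookup (colouring (swap x)) (vertex middle 0F)  ≡⟨ lookup-vertex (colouring (swap x)) middle 0F ⟩
        colouring (swap x) ⟨ middle , 0F ⟩              ≡⟨ u≡0′ ⟩
        0F                                              ∎)
        where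
        open ≡-Reasoning
        1F≢0F : _≢_ {A = Fin q} 1F 0F
        1F≢0F ()
      disjoint : ∀ x → lookup A x ≡ true → lookup A (swap x) ≡ false
      disjoint x Ax = trans (lookup∘tabulate _ (swap x)) (dec-false (intact? (colouring (swap x)) middle)
        (damaged x (intact⁻ (intact? (colouring x) middle) (trans (sym (lookup∘tabulate _ x)) Ax))))

    -- Drift and `f≤k1A` give k - 2tw ≤ k · μ, where μ is the probability of A at time t. With μ ≤
    -- 3/4 this becomes k ≤ 8tw, and multiplying by nq = 1/w removes w.
    slow : ∀ t → distanceAt P uniform t ≤ + 1 / 4 → fromℕ (k ℕ.* (n ℕ.* q)) ≤ fromℕ (8 ℕ.* t)
    slow t mixed = begin
      fromℕ (k ℕ.* (n ℕ.* q))
        ≡⟨ trans (fromℕ-* k (n ℕ.* q)) (trans (cong (fromℕ k *_) (fromℕ-* n q)) (*-comm (fromℕ k) (fromℕ n * fromℕ q))) ⟩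
      fromℕ n * fromℕ q * fromℕ k
        ≤⟨ *-monoˡ-≤′ (0≤*0≤ (0≤fromℕ n) (0≤fromℕ q)) k≤8tw ⟩
      fromℕ n * fromℕ q * (fromℕ 8 * (fromℕ t * w))
        ≡⟨ solve 6 (λ n q e t u c → n :* q :* (e :* (t :* (u :* c))) := e :* t :* ((n :* u) :* (q :* c))) refl
             (fromℕ n) (fromℕ q) (fromℕ 8) (fromℕ t) (uniform (vertex zero 0F)) (uniform {q} 0F) ⟩
      fromℕ 8 * fromℕ t * ((fromℕ n * uniform (vertex zero 0F)) * (fromℕ q * uniform {q} 0F))
        ≡⟨ cong (fromℕ 8 * fromℕ t *_) (cong₂ _*_ (fromℕ*uniform (vertex zero 0F)) (fromℕ*uniform {q} 0F)) ⟩
      fromℕ 8 * fromℕ t * (1ℚ * 1ℚ)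
        ≡⟨ trans (*-identityʳ _) (sym (fromℕ-* 8 t)) ⟩
      fromℕ (8 ℕ.* t) ∎
      where
      open ≤-Reasoning
      μ : ℚ
      μ = measure (power P t x₀) A
      μ≤¾ : μ ≤ + 3 / 4
      μ≤¾ = begin
        μ                                                ≡⟨ solve 2 (λ a b → a := (a :- b) :+ b) refl μ (measure uniform A) ⟩
        -- 1/4 from mixing plus 1/2 from the stationary measure.
        (μ - measure uniform A) + measure uniform A      ≤⟨ +-mono-≤ (≤-trans (distanceAt-≥ uniform t x₀ A) mixed) measure-A ⟩
        + 3 / 4                                          ∎
      k-2tw≤ : fromℕ k - fromℕ t * (w + w) ≤ fromℕ k * (+ 3 / 4)
      k-2tw≤ = begin
        fromℕ k - fromℕ t * (w + w)             ≤⟨ +-monoˡ-≤ (- (fromℕ t * (w + w))) k≤fx₀ ⟩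
        f x₀ - fromℕ t * (w + w)                ≤⟨ drift f radius-drop t x₀ ⟩
        expect t f x₀                           ≤⟨ expect-mono t f≤k1A x₀ ⟩
        expect t (λ y → 0ℚ + fromℕ k * 1A y) x₀ ≡⟨ expect-affine t 0ℚ (fromℕ k) 1A x₀ ⟩
        0ℚ + fromℕ k * expect t 1A x₀           ≡⟨ trans (+-identityˡ _) (cong (fromℕ k *_) (sym (measure-power t x₀ A))) ⟩
        fromℕ k * μ                             ≤⟨ *-monoˡ-≤′ (0≤fromℕ k) μ≤¾ ⟩
        fromℕ k * (+ 3 / 4)                     ∎
      k≤8tw : fromℕ k ≤ fromℕ 8 * (fromℕ t * w)
      k≤8tw = 0≤q-p⇒p≤q (subst (0ℚ ≤_)
        (solve 3 (λ k t w → con (fromℕ 4) :* (k :* con (+ 3 / 4) :- (k :- t :* (w :+ w))) := con (fromℕ 8) :* (t :* w) :- k)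
          refl (fromℕ k) (fromℕ t) w)
        (0≤*0≤ (0≤fromℕ 4) (p≤q⇒0≤q-p k-2tw≤)))

    mixing-bound : ∀ t → distanceAt P uniform t ≤ + 1 / 4 → (+ ((N ℕ.* q) ℕ.^ 2)) / (8 ℕ.* q) ≤ + t / 1
    mixing-bound t mixed = /-≤-fromℕ (n ℕ.^ 2) (8 ℕ.* q) t
      (square-bound n N q k t refl N≡2k (s≤s (s≤s z≤n)) (slow t mixed))

-- Assembling the theorem

open import Data.Integer.Base using (+_)
open import Data.Nat.Base using (ℕ; suc; _+_; _*_; _^_; _∸_; _≤_; z≤n; s≤s; parity)
open import Data.Nat.Properties using (+-identityʳ; m+[n∸m]≡n; ≤-trans; m≤m+n)
import Data.Parity.Properties as Parity
open import Data.Rational.Base using (_/_) renaming (_≤_ to _≤ℚ_)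
open MarkovChains
open GlauberDynamics
open Necklaces
open Connectedness
open SlowMixing

k+k-even : ∀ k → parity (k + k) ≡ 0ℙ
k+k-even k = trans (Parity.+-homo-+ k k) (Parity.p+p≡0ℙ (parity k))

pred-even-odd : ∀ n → parity (suc n) ≡ 0ℙ → parity n ≡ 1ℙ
pred-even-odd n even = trans (sym (Parity.suc-homo-⁻¹ n)) (cong _⁻¹ even)

module Conclusion (N-2 r : ℕ) (odd : parity (suc N-2) ≡ 1ℙ) (k : ℕ) (N≡2k : suc (suc N-2) ≡ k + k) where
  open Necklace N-2 (suc r)
  open Connectivity N-2 r odd using (connected)
  open LowerBound N-2 r odd k N≡2k using (x₀; mixing-bound)
  open NonFrozenChain G {q} (vertex zero zero) zero

  P-ergodic : IsErgodic P
  P-ergodic = ergodic connected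

  mixing : Σ[ τ ∈ ℕ ] (distanceAt P uniform τ ≤ℚ + 1 / 4 × IsMixingTime P τ)
  mixing = Chain.mixingTime P stochastic loop (IsErgodic.irreducible P-ergodic) (stationary x₀) x₀

  P-slow : Σ[ τ ∈ ℕ ] (IsMixingTime P τ × (+ ((N * q) ^ 2)) / (8 * q) ≤ℚ (+ τ) / 1)
  P-slow = let τ , mixed , mixes = mixing in τ , mixes , mixing-bound τ mixed

  -- n and Δ′ are separate variables so that the two forms of the bound are never compared by
  -- normalising rationals.
  theorem : ∀ {n Δ′} → n ≡ N * q → Δ′ ≡ Δ → Σ[ G ∈ Graph n ]
    (Graph.IsRegular G Δ′
    × IsErgodic (nonFrozenGlauber G (suc Δ′))
    × (Σ[ τ ∈ ℕ ] (IsMixingTime (nonFrozenGlauber G (suc Δ′)) τ × (+ (n ^ 2)) / (8 * suc Δ′) ≤ℚ (+ τ) / 1)))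
  theorem refl refl = G , regular , P-ergodic , P-slow

proposition3 : (Δ k : ℕ) → 3 ≤ Δ → 5 ≤ k →
    let n = 2 * k * suc Δ in
    Σ[ G ∈ Graph n ]
    (Graph.IsRegular G Δ
    × IsErgodic (nonFrozenGlauber G (suc Δ))
    × (Σ[ τ ∈ ℕ ] (IsMixingTime (nonFrozenGlauber G (suc Δ)) τ
    × (+ (n ^ 2)) / (8 * suc Δ) ≤ℚ (+ τ) / 1)))
proposition3 Δ k 3≤Δ 5≤k =
  -- There are N = 2k blobs and q = Δ + 1 = r + 4 colours, which fixes the first two arguments; both
  -- truncated subtractions are exact under the hypotheses.
  Conclusion.theorem (k + k ∸ 2) (Δ ∸ 3) odd k N≡2k
    (cong₂ _*_ (trans 2*k≡k+k (sym N≡2k)) (cong suc (sym 3+[Δ-3]≡Δ))) (sym 3+[Δ-3]≡Δ)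
  where
  2*k≡k+k : 2 * k ≡ k + k
  2*k≡k+k = cong (λ e → k + e) (+-identityʳ k)
  N≡2k : 2 + (k + k ∸ 2) ≡ k + k
  N≡2k = m+[n∸m]≡n {2} (≤-trans (s≤s (s≤s z≤n)) (≤-trans 5≤k (m≤m+n k k)))
  3+[Δ-3]≡Δ : 3 + (Δ ∸ 3) ≡ Δ
  3+[Δ-3]≡Δ = m+[n∸m]≡n 3≤Δ
  -- The index of the last blob is 2k - 1, and its oddness is how the even length of the cycle is
  -- expressed.
  odd : parity (suc (k + k ∸ 2)) ≡ 1ℙ
  odd = pred-even-odd (suc (k + k ∸ 2)) (trans (cong parity N≡2k) (k+k-even k))
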